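{- Let $c\ge2$, let $\mathcal{G}_1,\ldots,\mathcal{G}_c$ be fixed ordered graphs, each containing at least one edge, let $\boldsymbol{\lambda}=(\lambda_1,\ldots,\lambda_c)\in(0,\infty)^c$, and put $h_i=v(\mathcal{G}_i)$ and $R=\overline{\mathrm{R}}(\mathcal{G}_1,\ldots,\mathcal{G}_c)$. Fix an integer $t\ge R$, and set $J_t=\{i\in[c]:h_i\le t\}$ and $\delta_i=\delta_{h_i}(1/c)$ for $i\in J_t$. Then there exist $\varepsilon,\alpha>0$ and $n_0$ such that, for every $n\ge n_0$, every $c$-edge-coloring $\chi$ of $\mathcal{K}_n$ admits sets (clusters) $W_1<\cdots<W_t$ in $[n]$ with $|W_j|\ge\alpha n$ for all $j\in[t]$, which are pairwise $\varepsilon$-regular, and for which the following holds. Color each reduced edge $W_uW_v$ ($1\le u<v\le t$) by a color $\gamma$ maximizing the density $d_\gamma(W_u,W_v)$. Let $\mathcal{Q}_i$ be the family of order-preserving copies of $\mathcal{G}_i$ all of whose edges have color $i$ in this reduced coloring of the ordered complete graph on $W_1<\cdots<W_t$, and let $T_i^{\mathrm{reg}}$ be the number of color-$i$ order-preserving copies of $\mathcal{G}_i$ in $\mathcal{K}_n$ (under $\chi$) that arise from members of $\mathcal{Q}_i$, meeting every selected cluster in at most one vertex. Then $$T_i^{\mathrm{reg}}\ \ge\ \delta_i\sum_{F\in\mathcal{Q}_i}\ \prod_{W_j\in V(F)}|W_j|\qquad(i\in J_t),$$ and $$\sum_{i\in J_t}\frac{\lambda_iT_i^{\mathrm{reg}}}{\delta_i(\alpha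 n)^{h_i}}\ \ge\ \overline{\mathrm{M}}_{\boldsymbol{\lambda}}(t;\mathcal{G}_1,\ldots,\mathcal{G}_c).$$
   Context: An ordered graph is a finite graph with a linear order on its vertex set; $v(\mathcal{G})$ is its number of vertices. $[c]=\{1,\ldots,c\}$. $\mathcal{K}_n$ is the complete graph on $[n]$ with the natural order. An order-preserving copy of an ordered graph $\mathcal{H}$ in $\mathcal{G}$ is an injective map $V(\mathcal{H})\to V(\mathcal{G})$ that preserves the vertex order and maps every edge of $\mathcal{H}$ to an edge of $\mathcal{G}$; copies are counted by their vertex sets. For $\chi:E(\mathcal{K}_n)\to[c]$, $N_i(\chi;\mathcal{G}_i)$ is the number of order-preserving copies of $\mathcal{G}_i$ in $\mathcal{K}_n$ all of whose edges have color $i$. $\overline{\mathrm{R}}(\mathcal{G}_1,\ldots,\mathcal{G}_c)$ is the least $N$ such that every $c$-edge-coloring of $\mathcal{K}_N$ contains an order-preserving copy of $\mathcal{G}_i$ in color $i$ for some $i\in[c]$, and $$\overline{\mathrm{M}}_{\boldsymbol{\lambda}}(n;\mathcal{G}_1,\ldots,\mathcal{G}_c)=\min_{\chi:E(\mathcal{K}_n)\to[c]}\sum_{i=1}^{c}\lambda_iN_i(\chi;\mathcal{G}_i).$$ Given $\chi:E(\mathcal{K}_n)\to[c]$ and disjoint nonempty $A,B\subseteq[n]$, $d_\gamma(A,B)=e_\gamma(A,B)/(|A||B|)$, where $e_\gamma(A,B)$ is the number of edges of color $\gamma$ between $A$ and $B$. The pair $(A,B)$ is $\varepsilon$-regular if,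 whenever $X\subseteq A$, $Y\subseteq B$ satisfy $|X|\ge\varepsilon|A|$ and $|Y|\ge\varepsilon|B|$, one has $|d_\gamma(X,Y)-d_\gamma(A,B)|\le\varepsilon$ for every $\gamma\in[c]$. $W_1<\cdots<W_t$ means that every element of $W_u$ precedes every element of $W_v$ whenever $u<v$. A copy of $\mathcal{G}_i$ in $\mathcal{K}_n$ arises from $F\in\mathcal{Q}_i$, where $F$ has vertices $W_{a_1}<\cdots<W_{a_{h_i}}$, if for each $\ell\in[h_i]$ the $\ell$-th vertex of the copy lies in $W_{a_\ell}$. The constants $\delta_h(d)$, for $h\ge1$ and $0<d\le1$, are defined recursively by $\delta_1(d)=1$ and $\delta_h(d)=\frac12\,\delta_{h-1}(d/2)\left(\frac d2\right)^{h-1}$ for $h\ge2$. -}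

module Defs where

open import Algebra.Definitions.RawSemiring using (_^_)
open import Data.Fin as Fin using (Fin; finToFun; combine)
import Data.Fin.Properties as Fin
open import Data.Fin.Subset using (Subset; ∣_∣; _∈_; _⊆_)
open import Data.Fin.Subset.Properties using (_∈?_)
open import Data.Integer using (+_)
open import Data.List using (List; []; _∷_; allFin; cartesianProduct; filter; foldr; length; map)
open import Data.List.Relation.Unary.Any as Any using (Any)
open import Data.Nat as ℕ using (ℕ; zero; suc)
import Data.Nat.Properties as ℕ
open import Data.Nat.ListAction using (product; sum)
open import Data.Product using (Σ-syntax; ∃-syntax; _×_; _,_; proj₁; proj₂)
open import Data.Rational as ℚ using (ℚ; 0ℚ; 1ℚ; ½)
import Data.Rational.Properties as ℚ
open import Data.Rational.Solver using (module +-*-Solver)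
open import Data.Sum using (_⊎_; inj₁; inj₂)
open import Level using (0ℓ)
open import Relation.Binary using (Rel; Decidable; Symmetric; Irreflexive)
open import Relation.Binary.PropositionalEquality using (_≡_; refl; sym; trans; cong; cong₂; subst)
open import Relation.Nullary using (Dec; yes; no)
open import Relation.Nullary.Decidable using (_×-dec_; _⊎-dec_; _→-dec_)

fromℕ : ℕ → ℚ
fromℕ n = + n ℚ./ 1

infixr 8 _^ℚ_
_^ℚ_ : ℚ → ℕ → ℚ
_^ℚ_ = _^_ ℚ.+-*-rawSemiring

-- Division made total by p ÷₀ 0 = 0; the value at 0 carries no meaning.
infixl 7 _÷₀_
_÷₀_ : ℚ → ℚ → ℚ
p ÷₀ q with q ℚ.≟ 0ℚ
... | yes _   = 0ℚ
... | no q≢0 = (p ℚ.÷ q) {{ℚ.≢-nonZero q≢0}}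

-- Real numbers, as Cauchy sequences of rationals carrying a modulus.

IsCauchy : (ℕ → ℚ) → Set
IsCauchy x = ∀ ε → 0ℚ ℚ.< ε →
  ∃[ N ] (∀ m n → N ℕ.≤ m → N ℕ.≤ n → ℚ.∣ x m ℚ.- x n ∣ ℚ.≤ ε)

record ℝ : Set where
  constructor mkℝ
  field
    seq    : ℕ → ℚ
    cauchy : IsCauchy seq

open ℝ public

infix 4 _≤ᴿ_ _<ᴿ_

_≤ᴿ_ : Rel ℝ 0ℓ
x ≤ᴿ y = ∀ ε → 0ℚ ℚ.< ε → ∃[ N ] (∀ n → N ℕ.≤ n → seq x n ℚ.≤ seq y n ℚ.+ ε)

_<ᴿ_ : Rel ℝ 0ℓ
x <ᴿ y = ∃[ ε ] (0ℚ ℚ.< ε × ∃[ N ] (∀ n → N ℕ.≤ n → seq x n ℚ.+ ε ℚ.≤ seq y n))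

private
  open +-*-Solver using (solve; _:+_; _:*_; _:-_; :-_; con; _:=_)

  0<½* : ∀ {ε} → 0ℚ ℚ.< ε → 0ℚ ℚ.< ½ ℚ.* ε
  0<½* {ε} 0<ε = ℚ.positive⁻¹ _ {{ℚ.pos*pos⇒pos ½ ε {{ℚ.positive 0<ε}}}}

  halves : ∀ ε → ½ ℚ.* ε ℚ.+ ½ ℚ.* ε ≡ ε
  halves = solve 1 (λ e → con ½ :* e :+ con ½ :* e := e) refl

  p≤∣p∣ : ∀ p → p ℚ.≤ ℚ.∣ p ∣
  p≤∣p∣ p with ℚ.≤-total 0ℚ p
  ... | inj₁ 0≤p = ℚ.≤-reflexive (sym (ℚ.0≤p⇒∣p∣≡p 0≤p))
  ... | inj₂ p≤0 = ℚ.≤-trans p≤0 (ℚ.0≤∣p∣ p)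

  ∣-∣-lub : ∀ {p q} → p ℚ.≤ q → ℚ.- p ℚ.≤ q → ℚ.∣ p ∣ ℚ.≤ q
  ∣-∣-lub {p} p≤q -p≤q with ℚ.∣p∣≡p∨∣p∣≡-p p
  ... | inj₁ eq = subst (ℚ._≤ _) (sym eq) p≤q
  ... | inj₂ eq = subst (ℚ._≤ _) (sym eq) -p≤q

  ∣p-q∣≡∣q-p∣ : ∀ p q → ℚ.∣ p ℚ.- q ∣ ≡ ℚ.∣ q ℚ.- p ∣
  ∣p-q∣≡∣q-p∣ p q = trans
    (cong ℚ.∣_∣ (solve 2 (λ a b → a :- b := :- (b :- a)) refl p q))
    (ℚ.∣-p∣≡∣p∣ (q ℚ.- p))

  ⊓-diff : ∀ a b c d → (a ℚ.⊓ b) ℚ.- (c ℚ.⊓ d) ℚ.≤ ℚ.∣ a ℚ.- c ∣ ℚ.+ ℚ.∣ b ℚ.- d ∣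
  ⊓-diff a b c d with ℚ.⊓-sel c d
  ... | inj₁ eq rewrite eq = begin
    (a ℚ.⊓ b) ℚ.- c                     ≤⟨ ℚ.+-monoˡ-≤ (ℚ.- c) (ℚ.p⊓q≤p a b) ⟩
    a ℚ.- c                             ≤⟨ p≤∣p∣ (a ℚ.- c) ⟩
    ℚ.∣ a ℚ.- c ∣                       ≡⟨ ℚ.+-identityʳ _ ⟨
    ℚ.∣ a ℚ.- c ∣ ℚ.+ 0ℚ                ≤⟨ ℚ.+-monoʳ-≤ ℚ.∣ a ℚ.- c ∣ (ℚ.0≤∣p∣ (b ℚ.- d)) ⟩
    ℚ.∣ a ℚ.- c ∣ ℚ.+ ℚ.∣ b ℚ.- d ∣     ∎
    where open ℚ.≤-Reasoning
  ... | inj₂ eq rewrite eq = begin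
    (a ℚ.⊓ b) ℚ.- d                     ≤⟨ ℚ.+-monoˡ-≤ (ℚ.- d) (ℚ.p⊓q≤q a b) ⟩
    b ℚ.- d                             ≤⟨ p≤∣p∣ (b ℚ.- d) ⟩
    ℚ.∣ b ℚ.- d ∣                       ≡⟨ ℚ.+-identityˡ _ ⟨
    0ℚ ℚ.+ ℚ.∣ b ℚ.- d ∣                ≤⟨ ℚ.+-monoˡ-≤ ℚ.∣ b ℚ.- d ∣ (ℚ.0≤∣p∣ (a ℚ.- c)) ⟩
    ℚ.∣ a ℚ.- c ∣ ℚ.+ ℚ.∣ b ℚ.- d ∣     ∎
    where open ℚ.≤-Reasoning

  ∣⊓-diff∣ : ∀ a b c d → ℚ.∣ (a ℚ.⊓ b) ℚ.- (c ℚ.⊓ d) ∣ ℚ.≤ ℚ.∣ a ℚ.- c ∣ ℚ.+ ℚ.∣ b ℚ.- d ∣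
  ∣⊓-diff∣ a b c d = ∣-∣-lub (⊓-diff a b c d) (begin
    ℚ.- ((a ℚ.⊓ b) ℚ.- (c ℚ.⊓ d))       ≡⟨ solve 2 (λ p q → :- (p :- q) := q :- p) refl (a ℚ.⊓ b) (c ℚ.⊓ d) ⟩
    (c ℚ.⊓ d) ℚ.- (a ℚ.⊓ b)             ≤⟨ ⊓-diff c d a b ⟩
    ℚ.∣ c ℚ.- a ∣ ℚ.+ ℚ.∣ d ℚ.- b ∣     ≡⟨ cong₂ ℚ._+_ (∣p-q∣≡∣q-p∣ c a) (∣p-q∣≡∣q-p∣ d b) ⟩
    ℚ.∣ a ℚ.- c ∣ ℚ.+ ℚ.∣ b ℚ.- d ∣     ∎)
    where open ℚ.≤-Reasoning

  ∣+-diff∣ : ∀ a b c d → ℚ.∣ (a ℚ.+ b) ℚ.- (c ℚ.+ d) ∣ ℚ.≤ ℚ.∣ a ℚ.- c ∣ ℚ.+ ℚ.∣ b ℚ.- d ∣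
  ∣+-diff∣ a b c d = begin
    ℚ.∣ (a ℚ.+ b) ℚ.- (c ℚ.+ d) ∣       ≡⟨ cong ℚ.∣_∣ (solve 4 (λ a b c d →
      (a :+ b) :- (c :+ d) := (a :- c) :+ (b :- d)) refl a b c d) ⟩
    ℚ.∣ (a ℚ.- c) ℚ.+ (b ℚ.- d) ∣       ≤⟨ ℚ.∣p+q∣≤∣p∣+∣q∣ (a ℚ.- c) (b ℚ.- d) ⟩
    ℚ.∣ a ℚ.- c ∣ ℚ.+ ℚ.∣ b ℚ.- d ∣     ∎
    where open ℚ.≤-Reasoning

  -- A pointwise operation that is 1-Lipschitz for the ℓ¹ distance preserves Cauchy sequences.
  lipschitz : (_∙_ : ℚ → ℚ → ℚ) →
    (∀ a b c d → ℚ.∣ (a ∙ b) ℚ.- (c ∙ d) ∣ ℚ.≤ ℚ.∣ a ℚ.- c ∣ ℚ.+ ℚ.∣ b ℚ.- d ∣) →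
    ∀ {x y} → IsCauchy x → IsCauchy y → IsCauchy (λ n → x n ∙ y n)
  lipschitz _∙_ lip {x} {y} cx cy ε 0<ε with cx (½ ℚ.* ε) (0<½* 0<ε) | cy (½ ℚ.* ε) (0<½* 0<ε)
  ... | M , hM | N , hN = M ℕ.⊔ N , λ m n m≥ n≥ → begin
    ℚ.∣ (x m ∙ y m) ℚ.- (x n ∙ y n) ∣              ≤⟨ lip (x m) (y m) (x n) (y n) ⟩
    ℚ.∣ x m ℚ.- x n ∣ ℚ.+ ℚ.∣ y m ℚ.- y n ∣        ≤⟨ ℚ.+-mono-≤
      (hM m n (ℕ.≤-trans (ℕ.m≤m⊔n M N) m≥) (ℕ.≤-trans (ℕ.m≤m⊔n M N) n≥))
      (hN m n (ℕ.≤-trans (ℕ.m≤n⊔m M N) m≥) (ℕ.≤-trans (ℕ.m≤n⊔m M N) n≥)) ⟩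
    ½ ℚ.* ε ℚ.+ ½ ℚ.* ε                            ≡⟨ halves ε ⟩
    ε                                              ∎
    where open ℚ.≤-Reasoning

  record Bound (x : ℕ → ℚ) : Set where
    field
      bound     : ℚ
      positive  : ℚ.Positive bound
      from      : ℕ
      holds     : ∀ n → from ℕ.≤ n → ℚ.∣ x n ∣ ℚ.≤ bound

  bounded : ∀ {x} → IsCauchy x → Bound x
  bounded {x} cx with cx 1ℚ (ℚ.positive⁻¹ 1ℚ)
  ... | N , h = record
    { bound    = ℚ.∣ x N ∣ ℚ.+ 1ℚ
    ; positive = ℚ.nonNeg+pos⇒pos ℚ.∣ x N ∣ {{ℚ.∣-∣-nonNeg (x N)}} 1ℚ
    ; from     = N
    ; holds    = λ n N≤n → begin
        ℚ.∣ x n ∣                               ≡⟨ cong ℚ.∣_∣ (solve 2 (λ a b → a := b :+ (a :- b)) refl (x n) (x N)) ⟩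
        ℚ.∣ x N ℚ.+ (x n ℚ.- x N) ∣             ≤⟨ ℚ.∣p+q∣≤∣p∣+∣q∣ (x N) (x n ℚ.- x N) ⟩
        ℚ.∣ x N ∣ ℚ.+ ℚ.∣ x n ℚ.- x N ∣         ≤⟨ ℚ.+-monoʳ-≤ ℚ.∣ x N ∣ (h n N N≤n ℕ.≤-refl) ⟩
        ℚ.∣ x N ∣ ℚ.+ 1ℚ                        ∎
    }
    where open ℚ.≤-Reasoning

  *-mono : ∀ {p q r s} → 0ℚ ℚ.≤ p → p ℚ.≤ q → 0ℚ ℚ.≤ r → r ℚ.≤ s → p ℚ.* r ℚ.≤ q ℚ.* s
  *-mono {p} {q} {r} {s} 0≤p p≤q 0≤r r≤s = ℚ.≤-trans
    (ℚ.*-monoˡ-≤-nonNeg p {{ℚ.nonNegative 0≤p}} r≤s)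
    (ℚ.*-monoʳ-≤-nonNeg s {{ℚ.nonNegative (ℚ.≤-trans 0≤r r≤s)}} p≤q)

  *-cauchy : ∀ {x y} → IsCauchy x → IsCauchy y → IsCauchy (λ n → x n ℚ.* y n)
  *-cauchy {x} {y} cx cy ε 0<ε = K , λ m n m≥ n≥ →
    let open ℚ.≤-Reasoning in begin
    ℚ.∣ x m ℚ.* y m ℚ.- x n ℚ.* y n ∣
      ≡⟨ cong ℚ.∣_∣ (solve 4 (λ a b c d → a :* b :- c :* d := a :* (b :- d) :+ d :* (a :- c)) refl (x m) (y m) (x n) (y n)) ⟩
    ℚ.∣ x m ℚ.* (y m ℚ.- y n) ℚ.+ y n ℚ.* (x m ℚ.- x n) ∣
      ≤⟨ ℚ.∣p+q∣≤∣p∣+∣q∣ (x m ℚ.* (y m ℚ.- y n)) (y n ℚ.* (x m ℚ.- x n)) ⟩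
    ℚ.∣ x m ℚ.* (y m ℚ.- y n) ∣ ℚ.+ ℚ.∣ y n ℚ.* (x m ℚ.- x n) ∣
      ≡⟨ cong₂ ℚ._+_ (ℚ.∣p*q∣≡∣p∣*∣q∣ (x m) (y m ℚ.- y n)) (ℚ.∣p*q∣≡∣p∣*∣q∣ (y n) (x m ℚ.- x n)) ⟩
    ℚ.∣ x m ∣ ℚ.* ℚ.∣ y m ℚ.- y n ∣ ℚ.+ ℚ.∣ y n ∣ ℚ.* ℚ.∣ x m ℚ.- x n ∣
      ≤⟨ ℚ.+-mono-≤
          (*-mono (ℚ.0≤∣p∣ (x m)) (Bx.holds m (ℕ.≤-trans l₁ m≥)) (ℚ.0≤∣p∣ (y m ℚ.- y n))
                  (hN m n (ℕ.≤-trans l₄ m≥) (ℕ.≤-trans l₄ n≥)))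
          (*-mono (ℚ.0≤∣p∣ (y n)) (By.holds n (ℕ.≤-trans l₂ n≥)) (ℚ.0≤∣p∣ (x m ℚ.- x n))
                  (hM m n (ℕ.≤-trans l₃ m≥) (ℕ.≤-trans l₃ n≥))) ⟩
    Bx.bound ℚ.* (½ ℚ.* ε ℚ.* 1/Bx) ℚ.+ By.bound ℚ.* (½ ℚ.* ε ℚ.* 1/By)
      ≡⟨ solve 5 (λ b b' c c' e → b :* (e :* b') :+ c :* (e :* c') := (b :* b') :* e :+ (c :* c') :* e)
           refl Bx.bound 1/Bx By.bound 1/By (½ ℚ.* ε) ⟩
    (Bx.bound ℚ.* 1/Bx) ℚ.* (½ ℚ.* ε) ℚ.+ (By.bound ℚ.* 1/By) ℚ.* (½ ℚ.* ε)
      ≡⟨ cong₂ (λ p q → p ℚ.* (½ ℚ.* ε) ℚ.+ q ℚ.* (½ ℚ.* ε))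
           (ℚ.*-inverseʳ Bx.bound {{nzx}}) (ℚ.*-inverseʳ By.bound {{nzy}}) ⟩
    1ℚ ℚ.* (½ ℚ.* ε) ℚ.+ 1ℚ ℚ.* (½ ℚ.* ε)
      ≡⟨ solve 1 (λ e → con 1ℚ :* (con ½ :* e) :+ con 1ℚ :* (con ½ :* e) := e) refl ε ⟩
    ε ∎
    where
    module Bx = Bound (bounded {x} cx)
    module By = Bound (bounded {y} cy)
    nzx : ℚ.NonZero Bx.bound
    nzx = ℚ.pos⇒nonZero Bx.bound {{Bx.positive}}
    nzy : ℚ.NonZero By.bound
    nzy = ℚ.pos⇒nonZero By.bound {{By.positive}}
    1/Bx 1/By : ℚ
    1/Bx = (ℚ.1/ Bx.bound) {{nzx}}
    1/By = (ℚ.1/ By.bound) {{nzy}}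
    scaled : ∀ b .{{p : ℚ.Positive b}} → 0ℚ ℚ.< ½ ℚ.* ε ℚ.* (ℚ.1/ b) {{ℚ.pos⇒nonZero b}}
    scaled b = ℚ.positive⁻¹ _ {{ℚ.pos*pos⇒pos (½ ℚ.* ε) {{ℚ.positive (0<½* 0<ε)}} _ {{ℚ.1/pos⇒pos b}}}}
    MhM = cx (½ ℚ.* ε ℚ.* 1/By) (scaled By.bound {{By.positive}})
    NhN = cy (½ ℚ.* ε ℚ.* 1/Bx) (scaled Bx.bound {{Bx.positive}})
    M = proj₁ MhM
    hM = proj₂ MhM
    N = proj₁ NhN
    hN = proj₂ NhN
    K = (Bx.from ℕ.⊔ By.from) ℕ.⊔ (M ℕ.⊔ N)
    l₁ : Bx.from ℕ.≤ K
    l₁ = ℕ.≤-trans (ℕ.m≤m⊔n Bx.from By.from) (ℕ.m≤m⊔n _ (M ℕ.⊔ N))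
    l₂ : By.from ℕ.≤ K
    l₂ = ℕ.≤-trans (ℕ.m≤n⊔m Bx.from By.from) (ℕ.m≤m⊔n _ (M ℕ.⊔ N))
    l₃ : M ℕ.≤ K
    l₃ = ℕ.≤-trans (ℕ.m≤m⊔n M N) (ℕ.m≤n⊔m (Bx.from ℕ.⊔ By.from) _)
    l₄ : N ℕ.≤ K
    l₄ = ℕ.≤-trans (ℕ.m≤n⊔m M N) (ℕ.m≤n⊔m (Bx.from ℕ.⊔ By.from) _)

infixl 6 _+ᴿ_
infixl 7 _*ᴿ_ _⊓ᴿ_

fromℚ : ℚ → ℝ
fromℚ p = mkℝ (λ _ → p) λ ε 0<ε → 0 , λ _ _ _ _ →
  subst (λ q → ℚ.∣ q ∣ ℚ.≤ ε) (sym (ℚ.+-inverseʳ p)) (ℚ.<⇒≤ 0<ε)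

0ᴿ : ℝ
0ᴿ = fromℚ 0ℚ

_+ᴿ_ _*ᴿ_ _⊓ᴿ_ : ℝ → ℝ → ℝ
mkℝ x cx +ᴿ mkℝ y cy = mkℝ (λ n → x n ℚ.+ y n) (lipschitz ℚ._+_ ∣+-diff∣ {x} {y} cx cy)
mkℝ x cx *ᴿ mkℝ y cy = mkℝ (λ n → x n ℚ.* y n) (*-cauchy {x} {y} cx cy)
mkℝ x cx ⊓ᴿ mkℝ y cy = mkℝ (λ n → x n ℚ.⊓ y n) (lipschitz ℚ._⊓_ ∣⊓-diff∣ {x} {y} cx cy)

sumᴿ : List ℝ → ℝ
sumᴿ = foldr _+ᴿ_ 0ᴿ

-- The value at the empty list carries no meaning.
minimumᴿ : List ℝ → ℝ
minimumᴿ []           = 0ᴿ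
minimumᴿ (x ∷ [])     = x
minimumᴿ (x ∷ y ∷ ys) = x ⊓ᴿ minimumᴿ (y ∷ ys)

-- An h-element linear order is represented by Fin h.
record OrderedGraph : Set₁ where
  field
    v      : ℕ
    Adj    : Rel (Fin v) 0ℓ
    symm   : Symmetric Adj
    irrefl : Irreflexive _≡_ Adj
    adj?   : Decidable Adj

open OrderedGraph public

HasEdge : OrderedGraph → Set
HasEdge H = ∃[ x ] ∃[ y ] Adj H x y

-- A map E(𝒦ₙ) → [c]; an edge is the pair of its endpoints in increasing order.
Coloring : ℕ → ℕ → Set
Coloring n c = (a b : Fin n) → .(a Fin.< b) → Fin c

-- Every colouring occurs (with repetitions): the assignments enumerated are
-- defined on all ordered pairs and only read off at increasing ones.
colorings : ∀ n c → List (Coloring n c)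
colorings n c = map (λ k a b _ → finToFun {c} {n ℕ.* n} k (combine a b)) (allFin (c ℕ.^ (n ℕ.* n)))

module _ {n c : ℕ} (χ : Coloring n c) where

  -- The unordered pair {a, b} is an edge of colour γ.
  HasColor : Fin c → Fin n → Fin n → Set
  HasColor γ a b = (Σ[ a<b ∈ a Fin.< b ] χ a b a<b ≡ γ) ⊎ (Σ[ b<a ∈ b Fin.< a ] χ b a b<a ≡ γ)

  colorUp? : ∀ γ a b → Dec (Σ[ a<b ∈ a Fin.< b ] χ a b a<b ≡ γ)
  colorUp? γ a b with a Fin.<? b
  ... | no a≮b = no λ { (a<b , _) → a≮b a<b }
  ... | yes a<b with χ a b a<b Fin.≟ γ
  ...   | yes eq = yes (a<b , eq)
  ...   | no neq = no λ { (_ , eq) → neq eq }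

  hasColor? : ∀ γ a b → Dec (HasColor γ a b)
  hasColor? γ a b = colorUp? γ a b ⊎-dec colorUp? γ b a

Increasing : ∀ {h n} → (Fin h → Fin n) → Set
Increasing f = ∀ x y → x Fin.< y → f x Fin.< f y

-- f is an order-preserving copy of H in 𝒦ₙ, all of whose edges have colour γ.
-- Strict monotonicity makes f injective, so f maps edges to edges of 𝒦ₙ.
IsMonoCopy : ∀ {n c} → Coloring n c → Fin c → (H : OrderedGraph) → (Fin (v H) → Fin n) → Set
IsMonoCopy χ γ H f = Increasing f × (∀ x y → Adj H x y → HasColor χ γ (f x) (f y))

isMonoCopy? : ∀ {n c} (χ : Coloring n c) γ H f → Dec (IsMonoCopy χ γ H f)
isMonoCopy? χ γ H f =
  Fin.all? (λ x → Fin.all? λ y → (x Fin.<? y) →-dec (f x Fin.<? f y))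
  ×-dec
  Fin.all? (λ x → Fin.all? λ y → adj? H x y →-dec hasColor? χ γ (f x) (f y))

-- All maps Fin h → Fin n, each listed once.
maps : ∀ h n → List (Fin h → Fin n)
maps h n = map finToFun (allFin (n ℕ.^ h))

-- An increasing map is determined by its image, so listing maps lists each
-- vertex set of a copy exactly once.
monoCopies : ∀ {n c} → Coloring n c → Fin c → (H : OrderedGraph) → List (Fin (v H) → Fin n)
monoCopies {n} χ γ H = filter (isMonoCopy? χ γ H) (maps (v H) n)

#monoCopies : ∀ {n c} → Coloring n c → Fin c → OrderedGraph → ℕ
#monoCopies χ γ H = length (monoCopies χ γ H)

Arrows : ∀ {c} → (Fin c → OrderedGraph) → ℕ → Set
Arrows {c} G N = (χ : Coloring N c) → ∃[ i ] ∃[ f ] IsMonoCopy χ i (G i) f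

IsRamseyNumber : ∀ {c} → (Fin c → OrderedGraph) → ℕ → Set
IsRamseyNumber G R = Arrows G R × (∀ N → Arrows G N → R ℕ.≤ N)

weight : ∀ {n c} → (Fin c → ℝ) → (Fin c → OrderedGraph) → Coloring n c → ℝ
weight {c = c} wt G χ = sumᴿ (map (λ i → wt i *ᴿ fromℚ (fromℕ (#monoCopies χ i (G i)))) (allFin c))

minWeight : ∀ {c} → (Fin c → ℝ) → ℕ → (Fin c → OrderedGraph) → ℝ
minWeight {c} wt n G = minimumᴿ (map (weight wt G) (colorings n c))

module _ {n c : ℕ} (χ : Coloring n c) where

  inPair? : ∀ γ (A B : Subset n) ((a , b) : Fin n × Fin n) → Dec (a ∈ A × b ∈ B × HasColor χ γ a b)
  inPair? γ A B (a , b) = (a ∈? A) ×-dec ((b ∈? B) ×-dec hasColor? χ γ a b)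

  -- For disjoint A and B, pairs (a , b) in A × B correspond to edges between A and B.
  edgesBetween : Fin c → Subset n → Subset n → ℕ
  edgesBetween γ A B = length (filter (inPair? γ A B) (cartesianProduct (allFin n) (allFin n)))

  density : Fin c → Subset n → Subset n → ℚ
  density γ A B = fromℕ (edgesBetween γ A B) ÷₀ (fromℕ ∣ A ∣ ℚ.* fromℕ ∣ B ∣)

  Regular : ℚ → Subset n → Subset n → Set
  Regular ε A B = ∀ X Y → X ⊆ A → Y ⊆ B →
    ε ℚ.* fromℕ ∣ A ∣ ℚ.≤ fromℕ ∣ X ∣ → ε ℚ.* fromℕ ∣ B ∣ ℚ.≤ fromℕ ∣ Y ∣ →
    ∀ γ → ℚ.∣ density γ X Y ℚ.- density γ A B ∣ ℚ.≤ ε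

infix 4 _≺_
_≺_ : ∀ {n} → Rel (Subset n) 0ℓ
A ≺ B = ∀ {a b} → a ∈ A → b ∈ B → a Fin.< b

-- ρ is a colouring of the reduced edges W_a W_b by a densest colour, with
-- ties broken arbitrarily.
IsReducedColoring : ∀ {n c t} → Coloring n c → (Fin t → Subset n) → Coloring t c → Set
IsReducedColoring χ W ρ = ∀ a b .(a<b : a Fin.< b) γ →
  density χ γ (W a) (W b) ℚ.≤ density χ (ρ a b a<b) (W a) (W b)

-- The vertices of the reduced copy F are W (F 0) < W (F 1) < ….
ArisesFrom : ∀ {n t h} → (Fin t → Subset n) → (Fin h → Fin n) → (Fin h → Fin t) → Set
ArisesFrom W f F = ∀ ℓ → f ℓ ∈ W (F ℓ)

Transversal : ∀ {n t h} → (Fin t → Subset n) → (Fin h → Fin n) → Set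
Transversal W f = ∀ j x y → f x ∈ W j → f y ∈ W j → x ≡ y

module _ {n c t : ℕ} (χ : Coloring n c) (W : Fin t → Subset n) (ρ : Coloring t c)
         (i : Fin c) (H : OrderedGraph) where

  IsRegCopy : (Fin (v H) → Fin n) → Set
  IsRegCopy f = Any (ArisesFrom W f) (monoCopies ρ i H) × Transversal W f

  isRegCopy? : ∀ f → Dec (IsRegCopy f)
  isRegCopy? f =
    Any.any? (λ F → Fin.all? λ ℓ → f ℓ ∈? W (F ℓ)) (monoCopies ρ i H)
    ×-dec
    Fin.all? (λ j → Fin.all? λ x → Fin.all? λ y → (f x ∈? W j) →-dec ((f y ∈? W j) →-dec (x Fin.≟ y)))

  #regCopies : ℕ
  #regCopies = length (filter isRegCopy? (monoCopies χ i H))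

  clusterVolume : ℕ
  clusterVolume = sum (map (λ F → product (map (λ ℓ → ∣ W (F ℓ) ∣) (allFin (v H)))) (monoCopies ρ i H))

-- Only h ≥ 1 is meaningful.
δ : ℕ → ℚ → ℚ
δ zero          d = 1ℚ
δ (suc zero)    d = 1ℚ
δ (suc (suc h)) d = ½ ℚ.* δ (suc h) (½ ℚ.* d) ℚ.* (½ ℚ.* d) ^ℚ suc h

{-# OPTIONS --safe #-}

-- A pair of vertex sets is made regular in one colour by decreasing its
-- density: take the density bound to be (k + 1) / K, and as long as some
-- sub-pair has k / K of the possible edges minus more than a fraction 1 / K of
-- the edges of the whole pair, pass to it and lower k.  The surviving pair has
-- a lower bound on the density of every sub-pair, and subtracting complements
-- gives an upper bound too.  As both bounds have an additive error, they pass
-- to subsets at the cost of a larger relative error, so all pairs and colours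
-- can be treated one after another, provided the precision of each is chosen
-- after the shrinking caused by those still to come.  Starting from t
-- consecutive intervals this produces the clusters.
--
-- A reduced edge has density at least 1 / c in its colour, so every large
-- sub-pair has density at least 1 / (2c).  Embedding the vertices of a reduced
-- copy one by one, at least half of the current candidates for the first
-- vertex keep a fraction 1 / (2c) of every other candidate set, which is the
-- recursion of δ.  Distinct reduced copies give rise to distinct copies
-- because the clusters are disjoint.  The reduced colouring is one of those
-- over which the minimum is taken, and each of its copies F contributes at
-- least (α n) ^ h to the cluster volume.
module Submission where

open import Defs
open import Data.Fin as Fin using (Fin; zero; suc; toℕ; finToFun; funToFin; combine; remQuot; _↑ˡ_; _↑ʳ_)
import Data.Fin.Properties as Fin
open import Data.Fin.Subset using (Subset; ∣_∣; _∈_; _∉_; _⊆_; _∩_; _─_; inside; outside)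
open import Data.Fin.Subset.Properties
  using (_∈?_; _⊆?_; anySubset?; p─q⊆p; x∈p∧x∉q⇒x∈p─q; p⊆q⇒∣p∣≤∣q∣; p∩q⊆p; x∈p∩q⁺; x∈p∩q⁻)
open import Data.Bool using (if_then_else_)
import Data.Integer as ℤ
import Data.Integer.Properties as ℤ
open import Data.List as List using (List; []; _∷_; allFin; cartesianProduct; filter; length; map)
import Data.List.Properties as List
open import Data.List.Membership.Propositional using (lose) renaming (_∈_ to _∈ˡ_)
open import Data.List.Membership.Propositional.Properties using (∈-map⁺; ∈-allFin; ∈-filter⁺; ∈-cartesianProduct⁺)
open import Data.List.Relation.Unary.All as All using (All; []; _∷_)
open import Data.List.Relation.Unary.Any using (here; there)
open import Data.Nat as ℕ using (ℕ; zero; suc; _+_; _*_; _^_; _≤_; _<_; z≤n; s≤s)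
open import Data.Nat.DivMod using (_/_; m/n*n≤m; m≡m%n+[m/n]*n; m%n<n; m≥n⇒m/n>0)
open import Data.Nat.ListAction using (product) renaming (sum to Σₗ)
open import Data.Nat.ListAction.Properties using (sum-++)
import Data.Nat.Properties as ℕ
open import Data.Nat.Solver using (module +-*-Solver)
open import Data.Product using (Σ-syntax; ∃-syntax; _×_; _,_; proj₁; proj₂)
open import Data.Rational as ℚ using (ℚ; 0ℚ; 1ℚ; ½)
import Data.Rational.Properties as ℚ
import Data.Rational.Solver as ℚ
import Data.Rational.Unnormalised as ℚᵘ
import Data.Rational.Unnormalised.Properties as ℚᵘ
open import Data.Sum using (_⊎_; inj₁; inj₂; swap)
open import Data.Vec as Vec using ([]; _∷_)
open import Data.Vec.Functional using (updateAt)
open import Data.Vec.Functional.Properties using (updateAt-updates; updateAt-minimal)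
open import Data.Vec.Properties using (lookup∘tabulate; lookup⇒[]=; []=⇒lookup)
open import Function using (_∘_; id; const)
open import Relation.Binary using (tri<; tri≈; tri>)
open import Relation.Binary.PropositionalEquality
  using (_≡_; _≢_; refl; sym; trans; cong; cong₂; subst; subst₂; module ≡-Reasoning)
open import Relation.Nullary using (Dec; yes; no; does; ¬_; contradiction; contradiction-irr; recompute)
open import Relation.Nullary.Decidable using (_×-dec_; _→-dec_; ¬?; dec-true)

open import Algebra.Properties.Semiring.Sum ℕ.+-*-semiring
  using (sum-cong-≗; ∑-distrib-+; ∑-comm; *-distribˡ-sum; *-distribʳ-sum) renaming (sum to ∑)
open +-*-Solver using (solve; _:+_; _:*_; con; _:=_)
open ℚ.+-*-Solver using ()
  renaming (solve to solveℚ; _:+_ to _⊕_; _:*_ to _⊗_; _:-_ to _⊝_; :-_ to ⊖_; con to conℚ; _:=_ to _≐_)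

-- Finite sums and Iverson brackets

𝟙 : {P : Set} → Dec P → ℕ
𝟙 P? = if does P? then 1 else 0

𝟙-yes : {P : Set} (P? : Dec P) → P → 𝟙 P? ≡ 1
𝟙-yes (yes _) _ = refl
𝟙-yes (no ¬p) p = contradiction p ¬p

𝟙-no : {P : Set} (P? : Dec P) → ¬ P → 𝟙 P? ≡ 0
𝟙-no (yes p) ¬p = contradiction p ¬p
𝟙-no (no _) _  = refl

𝟙≤1 : {P : Set} (P? : Dec P) → 𝟙 P? ≤ 1
𝟙≤1 (yes _) = ℕ.≤-refl
𝟙≤1 (no _)  = z≤n

𝟙-mono : {P Q : Set} (P? : Dec P) (Q? : Dec Q) → (P → Q) → 𝟙 P? ≤ 𝟙 Q?
𝟙-mono (yes p) Q? f = ℕ.≤-reflexive (sym (𝟙-yes Q? (f p)))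
𝟙-mono (no _)  Q? f = z≤n

𝟙-cong : {P Q : Set} (P? : Dec P) (Q? : Dec Q) → (P → Q) → (Q → P) → 𝟙 P? ≡ 𝟙 Q?
𝟙-cong P? Q? f g = ℕ.≤-antisym (𝟙-mono P? Q? f) (𝟙-mono Q? P? g)

𝟙-× : {P Q : Set} (P? : Dec P) (Q? : Dec Q) → 𝟙 (P? ×-dec Q?) ≡ 𝟙 P? * 𝟙 Q?
𝟙-× (yes _) (yes _) = refl
𝟙-× (yes _) (no _)  = refl
𝟙-× (no _)  _       = refl

∑-mono : ∀ {n} {f g : Fin n → ℕ} → (∀ i → f i ≤ g i) → ∑ f ≤ ∑ g
∑-mono {zero}  f≤g = z≤n
∑-mono {suc n} f≤g = ℕ.+-mono-≤ (f≤g zero) (∑-mono (f≤g ∘ suc))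

∑-const : ∀ n m → ∑ {n} (λ _ → m) ≡ n * m
∑-const zero    m = refl
∑-const (suc n) m = cong (m +_) (∑-const n m)

∑-zero : ∀ {n} {f : Fin n → ℕ} → (∀ i → f i ≡ 0) → ∑ f ≡ 0
∑-zero {n} f≗0 = trans (sum-cong-≗ f≗0) (trans (∑-const n 0) (ℕ.*-zeroʳ n))

∑-≥-term : ∀ {n} (f : Fin n → ℕ) i → f i ≤ ∑ f
∑-≥-term f zero    = ℕ.m≤m+n _ _
∑-≥-term f (suc i) = ℕ.≤-trans (∑-≥-term (f ∘ suc) i) (ℕ.m≤n+m _ _)

-- This is what prevents overcounting: `Q` will say that a map is a copy being counted, and the
-- `P i` that it arises from the `i`-th reduced map.
∑-𝟙-unique : ∀ {n} {P : Fin n → Set} {Q : Set} (P? : ∀ i → Dec (P i)) (Q? : Dec Q) →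
  (∀ i → P i → Q) → (∀ i j → P i → P j → i ≡ j) → ∑ (λ i → 𝟙 (P? i)) ≤ 𝟙 Q?
∑-𝟙-unique {zero} P? Q? P⇒Q uniq = z≤n
∑-𝟙-unique {suc n} P? Q? P⇒Q uniq with P? zero
... | yes p = ℕ.≤-reflexive (trans
        (cong suc (∑-zero λ i → 𝟙-no (P? (suc i)) λ q → contradiction (uniq zero (suc i) p q) λ ()))
        (sym (𝟙-yes Q? (P⇒Q zero p))))
... | no _ = ∑-𝟙-unique (P? ∘ suc) Q? (P⇒Q ∘ suc)
               λ i j p q → Fin.suc-injective (uniq (suc i) (suc j) p q)

∑-↑ : ∀ m {n} (f : Fin (m + n) → ℕ) → ∑ f ≡ ∑ (λ i → f (i ↑ˡ n)) + ∑ (λ j → f (m ↑ʳ j))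
∑-↑ zero    f = refl
∑-↑ (suc m) f = trans (cong (f zero +_) (∑-↑ m (f ∘ suc))) (sym (ℕ.+-assoc (f zero) _ _))

∑-combine : ∀ m {n} (f : Fin (m * n) → ℕ) → ∑ f ≡ ∑ λ (i : Fin m) → ∑ λ (j : Fin n) → f (combine i j)
∑-combine zero        f = refl
∑-combine (suc m) {n} f = trans (∑-↑ n f) (cong (∑ (λ j → f (j ↑ˡ m * n)) +_) (∑-combine m (λ k → f (n ↑ʳ k))))

Σₗ-filter : ∀ {A : Set} {P : A → Set} (P? : ∀ x → Dec (P x)) (g : A → ℕ) xs →
  Σₗ (map g (filter P? xs)) ≡ Σₗ (map (λ x → 𝟙 (P? x) * g x) xs)
Σₗ-filter P? g []       = refl
Σₗ-filter P? g (x ∷ xs) with P? x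
... | yes _ = cong₂ _+_ (sym (ℕ.+-identityʳ (g x))) (Σₗ-filter P? g xs)
... | no  _ = Σₗ-filter P? g xs

Σₗ-allFin : ∀ {n} (g : Fin n → ℕ) → Σₗ (map g (allFin n)) ≡ ∑ g
Σₗ-allFin {n} g = trans (cong Σₗ (List.map-tabulate id g)) (go g)
  where
  go : ∀ {n} (g : Fin n → ℕ) → Σₗ (List.tabulate g) ≡ ∑ g
  go {zero}  g = refl
  go {suc n} g = cong (g zero +_) (go (g ∘ suc))

length-Σₗ : ∀ {A : Set} (xs : List A) → length xs ≡ Σₗ (map (λ _ → 1) xs)
length-Σₗ []       = refl
length-Σₗ (_ ∷ xs) = cong suc (length-Σₗ xs)

length-filter : ∀ {A : Set} {P : A → Set} (P? : ∀ x → Dec (P x)) xs →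
  length (filter P? xs) ≡ Σₗ (map (λ x → 𝟙 (P? x)) xs)
length-filter P? xs = trans (length-Σₗ (filter P? xs))
  (trans (Σₗ-filter P? _ xs) (cong Σₗ (List.map-cong (λ x → ℕ.*-identityʳ _) xs)))

Σₗ-cartesianProduct : ∀ {A B : Set} (g : A × B → ℕ) xs ys →
  Σₗ (map g (cartesianProduct xs ys)) ≡ Σₗ (map (λ x → Σₗ (map (λ y → g (x , y)) ys)) xs)
Σₗ-cartesianProduct g []       ys = refl
Σₗ-cartesianProduct g (x ∷ xs) ys = begin
  Σₗ (map g (map (x ,_) ys List.++ cartesianProduct xs ys))
    ≡⟨ cong Σₗ (List.map-++ g (map (x ,_) ys) _) ⟩
  Σₗ (map g (map (x ,_) ys) List.++ map g (cartesianProduct xs ys))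
    ≡⟨ sum-++ (map g (map (x ,_) ys)) _ ⟩
  Σₗ (map g (map (x ,_) ys)) + Σₗ (map g (cartesianProduct xs ys))
    ≡⟨ cong₂ _+_ (cong Σₗ (sym (List.map-∘ ys))) (Σₗ-cartesianProduct g xs ys) ⟩
  Σₗ (map (λ y → g (x , y)) ys) + Σₗ (map (λ x → Σₗ (map (λ y → g (x , y)) ys)) xs) ∎
  where open ≡-Reasoning

Σₗ-maps : ∀ h n (g : (Fin h → Fin n) → ℕ) → Σₗ (map g (maps h n)) ≡ ∑ λ (k : Fin (n ^ h)) → g (finToFun k)
Σₗ-maps h n g = trans (cong Σₗ (sym (List.map-∘ (allFin (n ^ h))))) (Σₗ-allFin (g ∘ finToFun))

-- Maps are coded in base `n` with the value at `zero` as leading digit, so a sum over codes splits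
-- by that digit. The hypothesis relating `g` and `g′` replaces function extensionality.
∑-finToFun-suc : ∀ h n (g : (Fin (suc h) → Fin n) → ℕ) (g′ : Fin n → (Fin h → Fin n) → ℕ) →
  (∀ f → g f ≡ g′ (f zero) (f ∘ suc)) →
  (∑ λ (k : Fin (n ^ suc h)) → g (finToFun k)) ≡ ∑ λ (a : Fin n) → ∑ λ (k : Fin (n ^ h)) → g′ a (finToFun k)
∑-finToFun-suc h n g g′ eq = trans (∑-combine n _) (sum-cong-≗ λ a → sum-cong-≗ λ k →
  trans (eq _) (cong (λ p → g′ (proj₁ p) (finToFun (proj₂ p))) (Fin.remQuot-combine a k)))

-- Sizes of subsets

𝟙∈ : ∀ {n} → Subset n → Fin n → ℕ
𝟙∈ S a = 𝟙 (a ∈? S)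

∣∣≡∑ : ∀ {n} (S : Subset n) → ∣ S ∣ ≡ ∑ (𝟙∈ S)
∣∣≡∑ []            = refl
∣∣≡∑ (inside ∷ S)  = cong suc (∣∣≡∑ S)
∣∣≡∑ (outside ∷ S) = ∣∣≡∑ S

𝟙∈-─ : ∀ {n} {S X : Subset n} → S ⊆ X → ∀ a → 𝟙∈ X a ≡ 𝟙∈ S a + 𝟙∈ (X ─ S) a
𝟙∈-─ {S = S} {X} S⊆X a with a ∈? S
... | yes a∈S = trans (𝟙-yes (a ∈? X) (S⊆X a∈S)) (cong suc (sym (𝟙-no (a ∈? (X ─ S)) (x∉p─q X S a∈S))))
  where
  x∉p─q : ∀ {n} {x : Fin n} (p q : Subset n) → x ∈ q → x ∉ (p ─ q)
  x∉p─q (inside ∷ p) (.inside ∷ q) Vec.here ()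
  x∉p─q (outside ∷ p) (.inside ∷ q) Vec.here ()
  x∉p─q (_ ∷ p) (_ ∷ q) (Vec.there x∈q) (Vec.there x∈) = x∉p─q p q x∈q x∈
... | no a∉S = 𝟙-cong (a ∈? X) (a ∈? (X ─ S)) (λ a∈X → x∈p∧x∉q⇒x∈p─q a∈X a∉S) (p─q⊆p X S)

∣∣-─ : ∀ {n} {S X : Subset n} → S ⊆ X → ∣ X ∣ ≡ ∣ S ∣ + ∣ X ─ S ∣
∣∣-─ {S = S} {X} S⊆X = begin
  ∣ X ∣                                ≡⟨ ∣∣≡∑ X ⟩
  ∑ (𝟙∈ X)                             ≡⟨ sum-cong-≗ (𝟙∈-─ S⊆X) ⟩
  ∑ (λ a → 𝟙∈ S a + 𝟙∈ (X ─ S) a)      ≡⟨ ∑-distrib-+ (𝟙∈ S) _ ⟩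
  ∑ (𝟙∈ S) + ∑ (𝟙∈ (X ─ S))            ≡⟨ cong₂ _+_ (∣∣≡∑ S) (∣∣≡∑ (X ─ S)) ⟨
  ∣ S ∣ + ∣ X ─ S ∣                    ∎
  where open ≡-Reasoning

-- Regularity of a pair in one colour

module _ {n : ℕ} (r : Fin n → Fin n → ℕ) where

  edges : Subset n → Subset n → ℕ
  edges S T = ∑ λ a → ∑ λ b → 𝟙∈ S a * (𝟙∈ T b * r a b)

  edges-splitˡ : ∀ {S X} T → S ⊆ X → edges X T ≡ edges S T + edges (X ─ S) T
  edges-splitˡ {S} {X} T S⊆X = trans
    (sum-cong-≗ λ a → trans
      (sum-cong-≗ λ b → trans
        (cong (_* (𝟙∈ T b * r a b)) (𝟙∈-─ S⊆X a))
        (ℕ.*-distribʳ-+ (𝟙∈ T b * r a b) (𝟙∈ S a) (𝟙∈ (X ─ S) a)))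
      (∑-distrib-+ (λ b → 𝟙∈ S a * (𝟙∈ T b * r a b)) _))
    (∑-distrib-+ (λ a → ∑ λ b → 𝟙∈ S a * (𝟙∈ T b * r a b)) _)

  edges-splitʳ : ∀ S {T Y} → T ⊆ Y → edges S Y ≡ edges S T + edges S (Y ─ T)
  edges-splitʳ S {T} {Y} T⊆Y = trans
    (sum-cong-≗ λ a → trans
      (sum-cong-≗ λ b → trans
        (cong (λ y → 𝟙∈ S a * (y * r a b)) (𝟙∈-─ T⊆Y b))
        (solve 4 (λ s t t′ x → s :* ((t :+ t′) :* x) := s :* (t :* x) :+ s :* (t′ :* x)) refl
          (𝟙∈ S a) (𝟙∈ T b) (𝟙∈ (Y ─ T) b) (r a b)))
      (∑-distrib-+ (λ b → 𝟙∈ S a * (𝟙∈ T b * r a b)) _))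
    (∑-distrib-+ (λ a → ∑ λ b → 𝟙∈ S a * (𝟙∈ T b * r a b)) _)

  edges-≤ : (∀ a b → r a b ≤ 1) → ∀ S T → edges S T ≤ ∣ S ∣ * ∣ T ∣
  edges-≤ r≤1 S T = begin
    edges S T
      ≤⟨ ∑-mono (λ a → ∑-mono λ b → ℕ.*-monoʳ-≤ (𝟙∈ S a)
           (ℕ.≤-trans (ℕ.*-monoʳ-≤ (𝟙∈ T b) (r≤1 a b)) (ℕ.≤-reflexive (ℕ.*-identityʳ _)))) ⟩
    ∑ (λ a → ∑ λ b → 𝟙∈ S a * 𝟙∈ T b)   ≡⟨ sum-cong-≗ (λ a → *-distribˡ-sum (𝟙∈ S a) (𝟙∈ T)) ⟨
    ∑ (λ a → 𝟙∈ S a * ∑ (𝟙∈ T))         ≡⟨ *-distribʳ-sum (∑ (𝟙∈ T)) (𝟙∈ S) ⟨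
    ∑ (𝟙∈ S) * ∑ (𝟙∈ T)                 ≡⟨ cong₂ _*_ (∣∣≡∑ S) (∣∣≡∑ T) ⟨
    ∣ S ∣ * ∣ T ∣                        ∎
    where open ℕ.≤-Reasoning

  -- Density at least `k / K`, up to an error of `1 / K` of all pairs in X × Y. Measuring the error
  -- against the whole pair avoids any size condition on S and T.
  LowerRegular : ℕ → ℕ → Subset n → Subset n → Set
  LowerRegular K k X Y = ∀ S T → S ⊆ X → T ⊆ Y → k * (∣ S ∣ * ∣ T ∣) ≤ K * edges S T + ∣ X ∣ * ∣ Y ∣

  lowerRegular-or-not : ∀ K k X Y → LowerRegular K k X Y ⊎
    ∃[ S ] ∃[ T ] (S ⊆ X × T ⊆ Y × K * edges S T + ∣ X ∣ * ∣ Y ∣ < k * (∣ S ∣ * ∣ T ∣))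
  lowerRegular-or-not K k X Y with anySubset? (λ S → anySubset? λ T →
    (S ⊆? X) ×-dec ((T ⊆? Y) ×-dec (K * edges S T + ∣ X ∣ * ∣ Y ∣ ℕ.<? k * (∣ S ∣ * ∣ T ∣))))
  ... | yes (S , T , S⊆X , T⊆Y , lt) = inj₂ (S , T , S⊆X , T⊆Y , lt)
  ... | no ∄ = inj₁ λ S T S⊆X T⊆Y → ℕ.≮⇒≥ λ lt → ∄ (S , T , S⊆X , T⊆Y , lt)

  record LowerRegularSubpair (K q : ℕ) (X Y : Subset n) : Set where
    field
      X′ Y′     : Subset n
      X′⊆X      : X′ ⊆ X
      Y′⊆Y      : Y′ ⊆ Y
      X-bound   : ∣ X ∣ ≤ q * ∣ X′ ∣
      Y-bound   : ∣ Y ∣ ≤ q * ∣ Y′ ∣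
      k         : ℕ
      lower     : LowerRegular K k X′ Y′
      sparse    : K * edges X′ Y′ ≤ suc k * (∣ X′ ∣ * ∣ Y′ ∣)

  private
    -- In x y < k s t ≤ K s y the factor y cancels. Hence a sub-pair violating lower regularity
    -- keeps at least a fraction `1 / K` of each class.
    large-factor : ∀ k K {x y s t} → k ≤ K → t ≤ y → x * y < k * (s * t) → x ≤ K * s
    large-factor k K {x} {zero} {s} {zero} k≤K t≤y xy<kst =
      contradiction xy<kst (ℕ.≤⇒≯ (ℕ.≤-trans (ℕ.≤-reflexive (trans (cong (k *_) (ℕ.*-zeroʳ s)) (ℕ.*-zeroʳ k))) z≤n))
    large-factor k K {x} {suc y} {s} {t} k≤K t≤y xy<kst = ℕ.*-cancelʳ-≤ x (K * s) (suc y) (begin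
      x * suc y        ≤⟨ ℕ.<⇒≤ xy<kst ⟩
      k * (s * t)      ≤⟨ ℕ.*-mono-≤ k≤K (ℕ.*-monoʳ-≤ s t≤y) ⟩
      K * (s * suc y)  ≡⟨ ℕ.*-assoc K s (suc y) ⟨
      K * s * suc y    ∎)
      where open ℕ.≤-Reasoning

  -- A sub-pair violating lower regularity at level suc k has density below
  -- suc k / K, so k can be decremented; at k = 0 there is nothing to violate.
  lowerRegularSubpair : ∀ K k X Y → k ≤ K → K * edges X Y ≤ suc k * (∣ X ∣ * ∣ Y ∣) →
    LowerRegularSubpair K (K ^ k) X Y
  lowerRegularSubpair K zero X Y k≤K sparse = record
    { X′ = X ; Y′ = Y ; X′⊆X = id ; Y′⊆Y = id
    ; X-bound = ℕ.≤-reflexive (sym (ℕ.*-identityˡ _)) ; Y-bound = ℕ.≤-reflexive (sym (ℕ.*-identityˡ _))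
    ; k = 0 ; lower = λ _ _ _ _ → z≤n ; sparse = sparse }
  lowerRegularSubpair K (suc k) X Y k<K sparse with lowerRegular-or-not K (suc k) X Y
  ... | inj₁ lower = record
    { X′ = X ; Y′ = Y ; X′⊆X = id ; Y′⊆Y = id
    ; X-bound = X≤ ∣ X ∣ ; Y-bound = X≤ ∣ Y ∣
    ; k = suc k ; lower = lower ; sparse = sparse }
    where
    X≤ : ∀ x → x ≤ K ^ suc k * x
    X≤ x = ℕ.m≤n*m x (K ^ suc k) {{ℕ.m^n≢0 K (suc k) {{ℕ.>-nonZero (ℕ.≤-trans (s≤s z≤n) k<K)}}}}
  ... | inj₂ (S , T , S⊆X , T⊆Y , lt) = record
    { X′ = X′ ; Y′ = Y′ ; X′⊆X = S⊆X ∘ X′⊆X ; Y′⊆Y = T⊆Y ∘ Y′⊆Y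
    ; X-bound = chain (large-factor (suc k) K k<K (p⊆q⇒∣p∣≤∣q∣ T⊆Y) xy<) X-bound
    ; Y-bound = chain (large-factor (suc k) K k<K (p⊆q⇒∣p∣≤∣q∣ S⊆X)
                        (subst₂ _<_ (ℕ.*-comm ∣ X ∣ ∣ Y ∣) (cong (suc k *_) (ℕ.*-comm ∣ S ∣ ∣ T ∣)) xy<)) Y-bound
    ; k = k′ ; lower = lower′ ; sparse = sparse′ }
    where
    rec : LowerRegularSubpair K (K ^ k) S T
    rec = lowerRegularSubpair K k S T (ℕ.<⇒≤ k<K) (ℕ.≤-trans (ℕ.m≤m+n _ _) (ℕ.<⇒≤ lt))
    open LowerRegularSubpair rec renaming (k to k′; lower to lower′; sparse to sparse′)
    -- The violation is used twice: without its term |X||Y| it is the sparsity needed by `rec`,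
    -- without its edge term it is the size bound needed by `large-factor`.
    xy< : ∣ X ∣ * ∣ Y ∣ < suc k * (∣ S ∣ * ∣ T ∣)
    xy< = ℕ.≤-<-trans (ℕ.m≤n+m _ _) lt
    chain : ∀ {x s s′} → x ≤ K * s → s ≤ K ^ k * s′ → x ≤ K ^ suc k * s′
    chain {s′ = s′} p q = ℕ.≤-trans p (ℕ.≤-trans (ℕ.*-monoʳ-≤ K q) (ℕ.≤-reflexive (sym (ℕ.*-assoc K (K ^ k) s′))))

  -- Density is at most 1 ≤ (K + 1) / K, so the descent can start at k = K. It has at most K steps,
  -- each costing a factor K.
  hasLowerRegularSubpair : (∀ a b → r a b ≤ 1) → ∀ K X Y → LowerRegularSubpair K (K ^ K) X Y
  hasLowerRegularSubpair r≤1 K X Y = lowerRegularSubpair K K X Y ℕ.≤-refl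
    (ℕ.*-mono-≤ (ℕ.n≤1+n K) (edges-≤ r≤1 X Y))

  -- Lower bounds for the edges between S and Y ─ T and between X ─ S and Y
  -- turn the bound on the edges between X and Y into one between S and T.
  upper : ∀ K k {X Y} → LowerRegular K k X Y → K * edges X Y ≤ suc k * (∣ X ∣ * ∣ Y ∣) →
    ∀ {S T} → S ⊆ X → T ⊆ Y → K * edges S T ≤ k * (∣ S ∣ * ∣ T ∣) + 3 * (∣ X ∣ * ∣ Y ∣)
  upper K k {X} {Y} lower sparse {S} {T} S⊆X T⊆Y = ℕ.+-cancelʳ-≤ (k * (s * t′) + k * (s′ * y)) _ _ (begin
    K * e₁ + (k * (s * t′) + k * (s′ * y))
      ≤⟨ ℕ.+-monoʳ-≤ (K * e₁) (ℕ.+-mono-≤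
           (lower S (Y ─ T) S⊆X (p─q⊆p Y T)) (lower (X ─ S) Y (p─q⊆p X S) id)) ⟩
    K * e₁ + ((K * e₂ + xy) + (K * e₃ + xy))
      ≡⟨ solve 5 (λ K e₁ e₂ e₃ w → K :* e₁ :+ ((K :* e₂ :+ w) :+ (K :* e₃ :+ w))
           := K :* ((e₁ :+ e₂) :+ e₃) :+ con 2 :* w) refl K e₁ e₂ e₃ xy ⟩
    K * (e₁ + e₂ + e₃) + 2 * xy
      ≡⟨ cong (λ e → K * e + 2 * xy) (trans (edges-splitˡ Y S⊆X) (cong (_+ e₃) (edges-splitʳ S T⊆Y))) ⟨
    K * edges X Y + 2 * xy
      ≤⟨ ℕ.+-monoˡ-≤ (2 * xy) sparse ⟩
    suc k * xy + 2 * xy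
      -- Of the three error terms, two come from the uses of `lower` and one from the successor in
      -- `sparse`.
      ≡⟨ solve 2 (λ k w → (con 1 :+ k) :* w :+ con 2 :* w := k :* w :+ con 3 :* w) refl k xy ⟩
    k * xy + 3 * xy
      ≡⟨ cong (λ w → k * w + 3 * xy) (trans (cong (_* y) (∣∣-─ S⊆X)) (ℕ.*-distribʳ-+ y s s′)) ⟩
    k * (s * y + s′ * y) + 3 * xy
      ≡⟨ cong (λ w → k * (s * w + s′ * y) + 3 * xy) (∣∣-─ T⊆Y) ⟩
    k * (s * (t + t′) + s′ * y) + 3 * xy
      ≡⟨ solve 6 (λ k s t t′ z w → k :* (s :* (t :+ t′) :+ z) :+ w
           := k :* (s :* t) :+ w :+ (k :* (s :* t′) :+ k :* z)) refl k s t t′ (s′ * y) (3 * xy) ⟩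
    k * (s * t) + 3 * xy + (k * (s * t′) + k * (s′ * y)) ∎)
    where
    open ℕ.≤-Reasoning
    s = ∣ S ∣
    s′ = ∣ X ─ S ∣
    t = ∣ T ∣
    t′ = ∣ Y ─ T ∣
    y = ∣ Y ∣
    xy = ∣ X ∣ * ∣ Y ∣
    e₁ = edges S T
    e₂ = edges S (Y ─ T)
    e₃ = edges (X ─ S) Y

  -- The densities of all sub-pairs of relative size at least 1 / M in each
  -- class lie within 1 / P of k / (P B).
  record Concentrated (M P : ℕ) (X Y : Subset n) : Set where
    field
      B     : ℕ
      B>0   : 0 < B
      k     : ℕ
      above : ∀ S T → S ⊆ X → T ⊆ Y → ∣ X ∣ ≤ M * ∣ S ∣ → ∣ Y ∣ ≤ M * ∣ T ∣ →
              k * (∣ S ∣ * ∣ T ∣) ≤ P * B * edges S T + B * (∣ S ∣ * ∣ T ∣)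
      below : ∀ S T → S ⊆ X → T ⊆ Y → ∣ X ∣ ≤ M * ∣ S ∣ → ∣ Y ∣ ≤ M * ∣ T ∣ →
              P * B * edges S T ≤ k * (∣ S ∣ * ∣ T ∣) + B * (∣ S ∣ * ∣ T ∣)

  -- Since |X′| ≤ Q|W| ≤ QM|S|, and likewise for Y′, the additive error 3|X′||Y′| is at most `B`
  -- times |S||T|; this determines `B`. The precision `P * B` of the given pair then leaves a
  -- relative error `1 / P`, independent of `Q`.
  concentrated : ∀ {M P Q q X Y} → 0 < M → 0 < Q → let B = 3 * ((Q * M) * (Q * M)) in
    (p : LowerRegularSubpair (P * B) q X Y) → let open LowerRegularSubpair p in
    ∀ {W Z} → W ⊆ X′ → Z ⊆ Y′ → ∣ X′ ∣ ≤ Q * ∣ W ∣ → ∣ Y′ ∣ ≤ Q * ∣ Z ∣ → Concentrated M P W Z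
  concentrated {M} {P} {Q} 0<M 0<Q p {W} {Z} W⊆X′ Z⊆Y′ X′≤QW Y′≤QZ = record
    { B = 3 * ((Q * M) * (Q * M))
    ; B>0 = ℕ.*-mono-≤ {1} {3} (s≤s z≤n) (ℕ.*-mono-≤ {1} 0<QM 0<QM)
    ; k = k
    ; above = λ S T S⊆W T⊆Z W≤MS Z≤MT → ℕ.≤-trans (lower S T (W⊆X′ ∘ S⊆W) (Z⊆Y′ ∘ T⊆Z))
        -- The lower bound has only one error term; it is weakened to three so that both bounds
        -- share `B`.
        (ℕ.+-monoʳ-≤ _ (ℕ.≤-trans (ℕ.m≤n*m _ 3) (error S T W≤MS Z≤MT)))
    ; below = λ S T S⊆W T⊆Z W≤MS Z≤MT → ℕ.≤-trans (upper (P * (3 * ((Q * M) * (Q * M)))) k lower sparse (W⊆X′ ∘ S⊆W) (Z⊆Y′ ∘ T⊆Z))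
        (ℕ.+-monoʳ-≤ _ (error S T W≤MS Z≤MT)) }
    where
    open LowerRegularSubpair p
    0<QM : 0 < Q * M
    0<QM = ℕ.*-mono-≤ {1} 0<Q 0<M
    scale : ∀ {x w s} → x ≤ Q * w → w ≤ M * s → x ≤ Q * M * s
    scale {s = s} x≤ w≤ = ℕ.≤-trans x≤ (ℕ.≤-trans (ℕ.*-monoʳ-≤ Q w≤) (ℕ.≤-reflexive (sym (ℕ.*-assoc Q M s))))
    error : ∀ S T → ∣ W ∣ ≤ M * ∣ S ∣ → ∣ Z ∣ ≤ M * ∣ T ∣ →
      3 * (∣ X′ ∣ * ∣ Y′ ∣) ≤ 3 * ((Q * M) * (Q * M)) * (∣ S ∣ * ∣ T ∣)
    error S T W≤MS Z≤MT = ℕ.≤-trans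
      (ℕ.*-monoʳ-≤ 3 (ℕ.*-mono-≤ (scale X′≤QW W≤MS) (scale Y′≤QZ Z≤MT)))
      (ℕ.≤-reflexive (solve 3 (λ a s t → con 3 :* ((a :* s) :* (a :* t)) := con 3 :* (a :* a) :* (s :* t)) refl
        (Q * M) ∣ S ∣ ∣ T ∣))

-- Regularising all pairs in all colours

AllConcentrated : ∀ {n t c} → ℕ → ℕ → (Fin c → Fin n → Fin n → ℕ) → (Fin t → Subset n) → List (Fin t × Fin t × Fin c) → Set
AllConcentrated M P r W = All λ (a , b , γ) → a Fin.< b → Concentrated (r γ) M P (W a) (W b)

-- The two updates do not interfere because their indices differ, and a nonzero `q` covers the
-- classes left alone.
replacePair : ∀ {n t q} → ℕ.NonZero q → ∀ {a b : Fin t} → a ≢ b → (V : Fin t → Subset n) →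
  ∀ {X Y} → X ⊆ V a → Y ⊆ V b → ∣ V a ∣ ≤ q * ∣ X ∣ → ∣ V b ∣ ≤ q * ∣ Y ∣ →
  Σ[ V′ ∈ (Fin t → Subset n) ] ((∀ j → V′ j ⊆ V j) × (∀ j → ∣ V j ∣ ≤ q * ∣ V′ j ∣) × V′ a ≡ X × V′ b ≡ Y)
replacePair {n} {t} {q} q≢0 {a} {b} a≢b V {X} {Y} X⊆ Y⊆ X≥ Y≥ =
  V′ , (λ j → proj₁ (shrunk j)) , (λ j → proj₂ (shrunk j)) , V′a , V′b
  where
  V₁ V′ : Fin t → Subset n
  V₁ = updateAt V a (const X)
  V′ = updateAt V₁ b (const Y)
  V′a : V′ a ≡ X
  V′a = trans (updateAt-minimal a b V₁ a≢b) (updateAt-updates a V)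
  V′b : V′ b ≡ Y
  V′b = updateAt-updates b V₁
  Shrunk : Fin t → Subset n → Set
  Shrunk j U = U ⊆ V j × ∣ V j ∣ ≤ q * ∣ U ∣
  shrunk : ∀ j → Shrunk j (V′ j)
  shrunk j with j Fin.≟ b
  ... | yes refl = subst (Shrunk b) (sym V′b) (Y⊆ , Y≥)
  ... | no j≢b with j Fin.≟ a
  ...   | yes refl = subst (Shrunk a) (sym V′a) (X⊆ , X≥)
  ...   | no j≢a = subst (Shrunk j) (sym (trans (updateAt-minimal j b V₁ j≢b) (updateAt-minimal j a V j≢a)))
            (id , ℕ.m≤n*m ∣ V j ∣ q {{q≢0}})

-- The constant for a pair is chosen after those of the pairs following it, so
-- that its regularity survives the later shrinking by a factor Q.
regularize : ∀ {t c} M P → 0 < M → 0 < P → (tasks : List (Fin t × Fin t × Fin c)) →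
  ∃[ Q ] (0 < Q × ∀ {n} (r : Fin c → Fin n → Fin n → ℕ) → (∀ γ a b → r γ a b ≤ 1) → (V : Fin t → Subset n) →
    Σ[ W ∈ (Fin t → Subset n) ] ((∀ j → W j ⊆ V j) × (∀ j → ∣ V j ∣ ≤ Q * ∣ W j ∣) × AllConcentrated M P r W tasks))
regularize M P 0<M 0<P [] = 1 , s≤s z≤n , λ r r≤1 V → V , (λ _ → id) , (λ j → ℕ.≤-reflexive (sym (ℕ.*-identityˡ _))) , []
regularize {t} M P 0<M 0<P ((a , b , γ) ∷ tasks) with regularize M P 0<M 0<P tasks
... | Q , 0<Q , shrink = q * Q , ℕ.*-mono-≤ {1} 0<q 0<Q , shrink′
  where
  K = P * (3 * ((Q * M) * (Q * M)))
  q = K ^ K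
  0<K : 0 < K
  0<K = ℕ.*-mono-≤ {1} 0<P (ℕ.*-mono-≤ {1} {3} (s≤s z≤n) (ℕ.*-mono-≤ {1} (ℕ.*-mono-≤ {1} 0<Q 0<M) (ℕ.*-mono-≤ {1} 0<Q 0<M)))
  0<q : 0 < q
  0<q = ℕ.m^n>0 K {{ℕ.>-nonZero 0<K}} K
  shrink′ : ∀ {n} (r : Fin _ → Fin n → Fin n → ℕ) → (∀ γ a b → r γ a b ≤ 1) → (V : Fin t → Subset n) →
    Σ[ W ∈ (Fin t → Subset n) ] ((∀ j → W j ⊆ V j) × (∀ j → ∣ V j ∣ ≤ q * Q * ∣ W j ∣) ×
      AllConcentrated M P r W ((a , b , γ) ∷ tasks))
  -- The tasks will be all triples. One with `a` not below `b` holds vacuously, and the factor `q`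
  -- is then a mere weakening.
  shrink′ {n} r r≤1 V with a Fin.<? b
  ... | no a≮b with shrink r r≤1 V
  ...   | W , W⊆V , V≤QW , conc = W , W⊆V
          , (λ j → ℕ.≤-trans (V≤QW j) (ℕ.*-monoˡ-≤ ∣ W j ∣ (ℕ.m≤n*m Q q {{ℕ.>-nonZero 0<q}})))
          , ((λ a<b → contradiction a<b a≮b) ∷ conc)
  shrink′ {n} r r≤1 V | yes a<b with replacePair (ℕ.>-nonZero 0<q) (Fin.<⇒≢ a<b) V X′⊆X Y′⊆Y X-bound Y-bound
    where
    open LowerRegularSubpair (hasLowerRegularSubpair (r γ) (r≤1 γ) K (V a) (V b))
  ... | V′ , V′⊆V , V≤qV′ , V′a , V′b with shrink r r≤1 V′
  ...   | W , W⊆V′ , V′≤QW , conc = W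
    , (λ j → V′⊆V j ∘ W⊆V′ j)
    , (λ j → ℕ.≤-trans (V≤qV′ j) (ℕ.≤-trans (ℕ.*-monoʳ-≤ q (V′≤QW j)) (ℕ.≤-reflexive (sym (ℕ.*-assoc q Q _)))))
    , ((λ _ → concentrated (r γ) 0<M 0<Q (hasLowerRegularSubpair (r γ) (r≤1 γ) K (V a) (V b))
          (subst (W a ⊆_) V′a (W⊆V′ a)) (subst (W b ⊆_) V′b (W⊆V′ b))
          (subst (λ U → ∣ U ∣ ≤ Q * ∣ W a ∣) V′a (V′≤QW a)) (subst (λ U → ∣ U ∣ ≤ Q * ∣ W b ∣) V′b (V′≤QW b))) ∷ conc)

-- Counting embeddings

⟦_⟧ : ∀ {n} {P : Fin n → Set} → (∀ a → Dec (P a)) → Subset n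
⟦ P? ⟧ = Vec.tabulate (does ∘ P?)

∈⟦⟧⁺ : ∀ {n} {P : Fin n → Set} (P? : ∀ a → Dec (P a)) {a} → P a → a ∈ ⟦ P? ⟧
∈⟦⟧⁺ P? {a} p = lookup⇒[]= a ⟦ P? ⟧ (trans (lookup∘tabulate (does ∘ P?) a) (dec-true (P? a) p))

∈⟦⟧⁻ : ∀ {n} {P : Fin n → Set} (P? : ∀ a → Dec (P a)) {a} → a ∈ ⟦ P? ⟧ → P a
∈⟦⟧⁻ P? {a} a∈ with P? a | trans (sym (lookup∘tabulate (does ∘ P?) a)) ([]=⇒lookup a∈)
... | yes p | _ = p

∏ : ∀ {h} → (Fin h → ℕ) → ℕ
∏ g = product (List.tabulate g)

∏-allFin : ∀ {h} (g : Fin h → ℕ) → product (map g (allFin h)) ≡ ∏ g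
∏-allFin g = cong product (List.map-tabulate id g)

∏-scale : ∀ {h} m {f g : Fin h → ℕ} → (∀ j → f j ≤ m * g j) → ∏ f ≤ m ^ h * ∏ g
∏-scale {zero}  m f≤mg = ℕ.≤-refl
∏-scale {suc h} m {f} {g} f≤mg = ℕ.≤-trans (ℕ.*-mono-≤ (f≤mg zero) (∏-scale m (f≤mg ∘ suc)))
  (ℕ.≤-reflexive (solve 4 (λ m g p q → (m :* g) :* (p :* q) := (m :* p) :* (g :* q)) refl m (g zero) (m ^ h) (∏ (g ∘ suc))))

-- The natural number 1 / δ_h(1 / m). Halving d doubles m, so the recursion of `δ` can be run inside
-- ℕ.
1/δ : ℕ → ℕ → ℕ
1/δ zero          m = 1
1/δ (suc zero)    m = 1
1/δ (suc (suc h)) m = 2 * (1/δ (suc h) (2 * m) * (2 * m) ^ suc h)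

module _ {n : ℕ} {Col : Fin n → Fin n → Set} (Col? : ∀ a b → Dec (Col a b)) where

  private
    r : Fin n → Fin n → ℕ
    r a b = 𝟙 (Col? a b)

  neighbours : Fin n → Subset n
  neighbours a = ⟦ Col? a ⟧

  ∣∩neighbours∣ : ∀ T a → ∣ T ∩ neighbours a ∣ ≡ ∑ λ b → 𝟙∈ T b * r a b
  ∣∩neighbours∣ T a = trans (∣∣≡∑ (T ∩ neighbours a)) (sum-cong-≗ λ b → trans
    (𝟙-cong (b ∈? (T ∩ neighbours a)) ((b ∈? T) ×-dec Col? a b)
      (λ b∈ → proj₁ (x∈p∩q⁻ T _ b∈) , ∈⟦⟧⁻ (Col? a) (proj₂ (x∈p∩q⁻ T _ b∈)))
      (λ { (b∈T , ab) → x∈p∩q⁺ (b∈T , ∈⟦⟧⁺ (Col? a) ab) }))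
    (𝟙-× (b ∈? T) (Col? a b)))

  edges-degrees : ∀ S T → edges r S T ≡ ∑ λ a → 𝟙∈ S a * ∣ T ∩ neighbours a ∣
  edges-degrees S T = sum-cong-≗ λ a → sym (trans
    (cong (𝟙∈ S a *_) (∣∩neighbours∣ T a)) (*-distribˡ-sum (𝟙∈ S a) (λ b → 𝟙∈ T b * r a b)))

  module _ {h : ℕ} {Adj : Fin h → Fin h → Set} (adj? : ∀ x y → Dec (Adj x y)) where

    -- Order and injectivity are left to the classes: when these are ordered clusters, both follow
    -- from membership. Colours are tested at x < y only, so that removing the first vertex leaves a
    -- condition of the same form.
    Embedding : (Fin h → Subset n) → (Fin h → Fin n) → Set
    Embedding A f = (∀ x → f x ∈ A x) × (∀ x y → x Fin.< y → Adj x y → Col (f x) (f y))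

    embedding? : ∀ A f → Dec (Embedding A f)
    embedding? A f = Fin.all? (λ x → f x ∈? A x) ×-dec
      Fin.all? (λ x → Fin.all? λ y → (x Fin.<? y) →-dec (adj? x y →-dec Col? (f x) (f y)))

    #embeddings : (Fin h → Subset n) → ℕ
    #embeddings A = ∑ λ (k : Fin (n ^ h)) → 𝟙 (embedding? A (finToFun k))

  module _ {h : ℕ} {Adj : Fin (suc h) → Fin (suc h) → Set} (adj? : ∀ x y → Dec (Adj x y))
           (A : Fin (suc h) → Subset n) where

    private
      adj?⁺ : ∀ x y → Dec (Adj (suc x) (suc y))
      adj?⁺ x y = adj? (suc x) (suc y)

    restrict : Fin n → Fin h → Subset n
    restrict a j with adj? zero (suc j)
    ... | yes _ = A (suc j) ∩ neighbours a
    ... | no  _ = A (suc j)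

    restrict-⊆ : ∀ a j → restrict a j ⊆ A (suc j)
    restrict-⊆ a j with adj? zero (suc j)
    ... | yes _ = p∩q⊆p _ _
    ... | no  _ = id

    ∈-restrict⁺ : ∀ {a b} j → b ∈ A (suc j) → (Adj zero (suc j) → Col a b) → b ∈ restrict a j
    ∈-restrict⁺ {a} j b∈ col with adj? zero (suc j)
    ... | yes adj = x∈p∩q⁺ (b∈ , ∈⟦⟧⁺ (Col? a) (col adj))
    ... | no _    = b∈

    ∈-restrict⁻ : ∀ {a b} j → b ∈ restrict a j → Adj zero (suc j) → Col a b
    ∈-restrict⁻ {a} j b∈ adj with adj? zero (suc j)
    ... | yes _   = ∈⟦⟧⁻ (Col? a) (proj₂ (x∈p∩q⁻ (A (suc j)) _ b∈))
    ... | no ¬adj = contradiction adj ¬adj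

    -- Once the first vertex is placed at `a`, its colour conditions become membership in the
    -- restricted classes, and what remains is an embedding problem with one vertex fewer.
    #embeddings-suc : #embeddings adj? A ≡ ∑ λ a → 𝟙∈ (A zero) a * #embeddings adj?⁺ (restrict a)
    #embeddings-suc = trans
      (∑-finToFun-suc h n (𝟙 ∘ embedding? adj? A)
        (λ a f → 𝟙∈ (A zero) a * 𝟙 (embedding? adj?⁺ (restrict a) f))
        (λ f → trans
          (𝟙-cong (embedding? adj? A f) ((f zero ∈? A zero) ×-dec embedding? adj?⁺ (restrict (f zero)) (f ∘ suc))
            (λ { (f∈ , col) → f∈ zero
                , (λ j → ∈-restrict⁺ j (f∈ (suc j)) (col zero (suc j) (s≤s z≤n)))
                , λ x y x<y → col (suc x) (suc y) (s≤s x<y) })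
            (λ { (f₀∈ , f∈ , col) → (λ { zero → f₀∈ ; (suc j) → restrict-⊆ _ j (f∈ j) })
                , λ { zero (suc j) _ → ∈-restrict⁻ j (f∈ j)
                    ; (suc x) (suc y) (s≤s x<y) → col x y x<y } }))
          (𝟙-× (f zero ∈? A zero) (embedding? adj?⁺ (restrict (f zero)) (f ∘ suc)))))
      (sum-cong-≗ λ a → sym (*-distribˡ-sum (𝟙∈ (A zero) a)
        (λ (k : Fin (n ^ h)) → 𝟙 (embedding? adj?⁺ (restrict a) (finToFun k)))))

  #embeddings-zero : ∀ {Adj : Fin 0 → Fin 0 → Set} (adj? : ∀ x y → Dec (Adj x y)) A → #embeddings adj? A ≡ 1
  #embeddings-zero adj? A = cong (_+ 0) (𝟙-yes (embedding? adj? A (finToFun zero)) ((λ ()) , (λ ())))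

  -- The reference sizes `x` and `y` are independent of X and Y, so the property passes unchanged to
  -- smaller classes.
  DensePair : ℕ → ℕ → ℕ → ℕ → Subset n → Subset n → Set
  DensePair m M x y X Y = ∀ S T → S ⊆ X → T ⊆ Y → x ≤ M * ∣ S ∣ → y ≤ M * ∣ T ∣ →
    ∣ S ∣ * ∣ T ∣ ≤ m * edges r S T

  module _ {h : ℕ} {Adj : Fin (suc h) → Fin (suc h) → Set} (adj? : ∀ x y → Dec (Adj x y))
           {m M L : ℕ} (0<m : 0 < m) (0<L : 0 < L) (A : Fin (suc h) → Subset n) (B : Fin (suc h) → ℕ)
           (L≤M : 2 * (suc h * (m ^ suc h * L)) ≤ M)
           (B≤LA : ∀ x → B x ≤ L * ∣ A x ∣)
           (dense : ∀ x y → x Fin.< y → Adj x y → DensePair m M (B x) (B y) (A x) (A y)) where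

    private
      instance
        _ = ℕ.>-nonZero 0<m
        _ = ℕ.>-nonZero 0<L

      -- The power of `m` in the bound on `M` is reserved for the growth of `L` in later steps of
      -- the induction.
      suc-h*L≤M : 2 * (suc h * L) ≤ M
      suc-h*L≤M = ℕ.≤-trans (ℕ.*-monoʳ-≤ 2 (ℕ.*-monoʳ-≤ (suc h) (ℕ.m≤n*m L (m ^ suc h) {{ℕ.m^n≢0 m (suc h)}}))) L≤M

      Typical : Fin n → Fin h → Set
      Typical a j = ∣ A (suc j) ∣ ≤ m * ∣ restrict adj? A a j ∣

      typical? : ∀ a j → Dec (Typical a j)
      typical? a j = ∣ A (suc j) ∣ ℕ.≤? m * ∣ restrict adj? A a j ∣

      atypical? : ∀ j a → Dec (a ∈ A zero × ¬ Typical a j)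
      atypical? j a = (a ∈? A zero) ×-dec ¬? (typical? a j)

      atypical : Fin h → Subset n
      atypical j = ⟦ atypical? j ⟧

      -- A class that is not restricted keeps all its elements and m ≥ 1, so only a class adjacent
      -- to the first vertex can shrink too much.
      atypical⇒adj : ∀ a j → ¬ Typical a j → Adj zero (suc j) × m * ∣ A (suc j) ∩ neighbours a ∣ < ∣ A (suc j) ∣
      atypical⇒adj a j ¬typ with adj? zero (suc j)
      ... | yes adj = adj , ℕ.≰⇒> ¬typ
      ... | no _    = contradiction (ℕ.m≤n*m _ m) ¬typ

      -- Each atypical `a` satisfies m deg(a) + 1 ≤ |T|. Summing over S collects the surplus |S|,
      -- which makes the bound strict unless S is empty.
      atypical-sparse : ∀ j → m * edges r (atypical j) (A (suc j)) + ∣ atypical j ∣ ≤ ∣ atypical j ∣ * ∣ A (suc j) ∣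
      atypical-sparse j = begin
        m * edges r S T + ∣ S ∣
          ≡⟨ cong₂ _+_ (trans (cong (m *_) (edges-degrees S T)) (*-distribˡ-sum m (λ a → 𝟙∈ S a * ∣ T ∩ neighbours a ∣))) (∣∣≡∑ S) ⟩
        ∑ (λ a → m * (𝟙∈ S a * ∣ T ∩ neighbours a ∣)) + ∑ (𝟙∈ S)
          ≡⟨ ∑-distrib-+ (λ a → m * (𝟙∈ S a * ∣ T ∩ neighbours a ∣)) (𝟙∈ S) ⟨
        ∑ (λ a → m * (𝟙∈ S a * ∣ T ∩ neighbours a ∣) + 𝟙∈ S a)
          ≤⟨ ∑-mono pointwise ⟩
        ∑ (λ a → 𝟙∈ S a * ∣ T ∣)
          ≡⟨ *-distribʳ-sum ∣ T ∣ (𝟙∈ S) ⟨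
        ∑ (𝟙∈ S) * ∣ T ∣
          ≡⟨ cong (_* ∣ T ∣) (∣∣≡∑ S) ⟨
        ∣ S ∣ * ∣ T ∣ ∎
        where
        open ℕ.≤-Reasoning
        S = atypical j
        T = A (suc j)
        pointwise : ∀ a → m * (𝟙∈ S a * ∣ T ∩ neighbours a ∣) + 𝟙∈ S a ≤ 𝟙∈ S a * ∣ T ∣
        pointwise a with a ∈? S
        ... | no _ = ℕ.≤-reflexive (trans (ℕ.+-identityʳ _) (ℕ.*-zeroʳ m))
        ... | yes a∈S = begin
          m * (1 * ∣ T ∩ neighbours a ∣) + 1   ≡⟨ cong (λ z → m * z + 1) (ℕ.*-identityˡ _) ⟩
          m * ∣ T ∩ neighbours a ∣ + 1         ≡⟨ ℕ.+-comm _ 1 ⟩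
          suc (m * ∣ T ∩ neighbours a ∣)       ≤⟨ proj₂ (atypical⇒adj a j (proj₂ (∈⟦⟧⁻ (atypical? j) a∈S))) ⟩
          ∣ T ∣                                ≡⟨ ℕ.*-identityˡ ∣ T ∣ ⟨
          1 * ∣ T ∣                            ∎

      atypical-adj : ∀ j → ∣ atypical j ∣ ≡ 0 ⊎ Adj zero (suc j)
      atypical-adj j with Fin.any? (λ a → a ∈? atypical j)
      ... | yes (a , a∈) = inj₂ (proj₁ (atypical⇒adj a j (proj₂ (∈⟦⟧⁻ (atypical? j) a∈))))
      ... | no ∄ = inj₁ (trans (∣∣≡∑ (atypical j)) (∑-zero λ a → 𝟙-no (a ∈? atypical j) λ a∈ → ∄ (a , a∈)))

      -- If the atypical set S is large enough for `dense`, then |S||T| ≤ m e(S, T), and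
      -- `atypical-sparse` forces S to be empty. Otherwise M|S| < B zero ≤ L|A zero|, and the choice
      -- of `M` gives the claim.
      few-atypical : ∀ j → 2 * (suc h * ∣ atypical j ∣) ≤ ∣ A zero ∣
      few-atypical j with atypical-adj j
      ... | inj₁ eq = subst (λ z → 2 * (suc h * z) ≤ ∣ A zero ∣) (sym eq)
              (ℕ.≤-trans (ℕ.≤-reflexive (cong (2 *_) (ℕ.*-zeroʳ (suc h)))) z≤n)
      ... | inj₂ adj with B zero ℕ.≤? M * ∣ atypical j ∣
      ...   | no  B≰ = ℕ.*-cancelˡ-≤ L (begin
              L * (2 * (suc h * s))   ≡⟨ solve 3 (λ L h s → L :* (con 2 :* (h :* s)) := con 2 :* (h :* L) :* s) refl L (suc h) s ⟩
              2 * (suc h * L) * s     ≤⟨ ℕ.*-monoˡ-≤ s suc-h*L≤M ⟩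
              M * s                   ≤⟨ ℕ.<⇒≤ (ℕ.≰⇒> B≰) ⟩
              B zero                  ≤⟨ B≤LA zero ⟩
              L * ∣ A zero ∣          ∎)
              where
              open ℕ.≤-Reasoning
              s = ∣ atypical j ∣
      ...   | yes B≤ = subst (λ z → 2 * (suc h * z) ≤ ∣ A zero ∣) (sym (empty ∣ atypical j ∣ (atypical-sparse j)
                (dense zero (suc j) (s≤s z≤n) adj (atypical j) (A (suc j)) (proj₁ ∘ ∈⟦⟧⁻ (atypical? j)) id B≤ B≤′)))
                (ℕ.≤-trans (ℕ.≤-reflexive (cong (2 *_) (ℕ.*-zeroʳ (suc h)))) z≤n)
              where
              B≤′ : B (suc j) ≤ M * ∣ A (suc j) ∣
              B≤′ = ℕ.≤-trans (B≤LA (suc j)) (ℕ.*-monoˡ-≤ _ (ℕ.≤-trans (ℕ.≤-trans (ℕ.m≤n*m L (suc h)) (ℕ.m≤n*m _ 2)) suc-h*L≤M))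
              empty : ∀ s {e x} → e + s ≤ x → x ≤ e → s ≡ 0
              empty s {e} e+s≤x x≤e = ℕ.n≤0⇒n≡0 (ℕ.+-cancelˡ-≤ e s 0 (ℕ.≤-trans (ℕ.≤-trans e+s≤x x≤e) (ℕ.m≤m+n e 0)))

      allTypical? : ∀ a → Dec (∀ j → Typical a j)
      allTypical? a = Fin.all? (typical? a)

      #typical : ℕ
      #typical = ∑ λ a → 𝟙∈ (A zero) a * 𝟙 (allTypical? a)

      typical-or-atypical : ∣ A zero ∣ ≤ #typical + ∑ λ j → ∣ atypical j ∣
      typical-or-atypical = begin
        ∣ A zero ∣        ≡⟨ ∣∣≡∑ (A zero) ⟩
        ∑ (𝟙∈ (A zero))  ≤⟨ ∑-mono pointwise ⟩
        ∑ (λ a → 𝟙∈ (A zero) a * 𝟙 (allTypical? a) + ∑ λ j → 𝟙∈ (atypical j) a)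
          ≡⟨ ∑-distrib-+ (λ a → 𝟙∈ (A zero) a * 𝟙 (allTypical? a)) _ ⟩
        #typical + ∑ (λ a → ∑ λ j → 𝟙∈ (atypical j) a)
          ≡⟨ cong (#typical +_) (∑-comm (λ a j → 𝟙∈ (atypical j) a)) ⟩
        #typical + ∑ (λ j → ∑ λ a → 𝟙∈ (atypical j) a)
          ≡⟨ cong (#typical +_) (sum-cong-≗ (λ j → ∣∣≡∑ (atypical j))) ⟨
        #typical + ∑ (λ j → ∣ atypical j ∣) ∎
        where
        open ℕ.≤-Reasoning
        pointwise : ∀ a → 𝟙∈ (A zero) a ≤ 𝟙∈ (A zero) a * 𝟙 (allTypical? a) + ∑ λ j → 𝟙∈ (atypical j) a
        pointwise a = cases (a ∈? A zero) (allTypical? a)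
          where
          cases : (p? : Dec (a ∈ A zero)) (q? : Dec (∀ j → Typical a j)) → 𝟙 p? ≤ 𝟙 p? * 𝟙 q? + ∑ λ j → 𝟙∈ (atypical j) a
          cases (no _)   _       = z≤n
          cases (yes _)  (yes _) = s≤s z≤n
          cases (yes a∈) (no ¬all) with Fin.¬∀⟶∃¬ h (Typical a) (typical? a) ¬all
          ... | j , ¬typ = ℕ.≤-trans
                  (ℕ.≤-reflexive (sym (𝟙-yes (a ∈? atypical j) (∈⟦⟧⁺ (atypical? j) (a∈ , ¬typ)))))
                  (∑-≥-term (λ j → 𝟙∈ (atypical j) a) j)

      -- By `few-atypical` each of the h atypical sets has at most 1 / (2(h + 1)) of `A zero`, so at
      -- least half remains outside their union.
      half-typical : ∣ A zero ∣ ≤ 2 * #typical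
      half-typical = ℕ.+-cancelʳ-≤ x x (2 * #typical) (begin
        x + x                          ≡⟨ solve 1 (λ x → x :+ x := con 2 :* x) refl x ⟩
        2 * x                          ≤⟨ ℕ.*-monoʳ-≤ 2 typical-or-atypical ⟩
        2 * (#typical + Σatypical)     ≡⟨ ℕ.*-distribˡ-+ 2 #typical Σatypical ⟩
        2 * #typical + 2 * Σatypical   ≤⟨ ℕ.+-monoʳ-≤ (2 * #typical) 2*Σ≤ ⟩
        2 * #typical + x               ∎)
        where
        open ℕ.≤-Reasoning
        x = ∣ A zero ∣
        Σatypical = ∑ λ j → ∣ atypical j ∣
        2*Σ≤ : 2 * Σatypical ≤ x
        -- Working with h + 1 rather than h keeps the cancelled factor nonzero when h = 0.
        2*Σ≤ = ℕ.*-cancelˡ-≤ (suc h) (begin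
          suc h * (2 * Σatypical)                       ≡⟨ solve 2 (λ h s → h :* (con 2 :* s) := con 2 :* (h :* s)) refl (suc h) Σatypical ⟩
          2 * (suc h * Σatypical)                       ≡⟨ cong (2 *_) (*-distribˡ-sum (suc h) (λ j → ∣ atypical j ∣)) ⟩
          2 * ∑ (λ j → suc h * ∣ atypical j ∣)          ≡⟨ *-distribˡ-sum 2 (λ j → suc h * ∣ atypical j ∣) ⟩
          ∑ (λ j → 2 * (suc h * ∣ atypical j ∣))        ≤⟨ ∑-mono few-atypical ⟩
          ∑ {h} (λ _ → x)                               ≡⟨ ∑-const h x ⟩
          h * x                                         ≤⟨ ℕ.*-monoˡ-≤ x (ℕ.n≤1+n h) ⟩
          suc h * x                                     ∎)

    -- Only typical choices of the first vertex are counted, which costs the factor 2. Each of them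
    -- shrinks the other h classes by at most `m`, hence the factor `m ^ h` in the product and
    -- `m * L` in place of `L` in the size bound handed to `rest`.
    #embeddings-step : ∀ {D} →
      (∀ a → (∀ j → B (suc j) ≤ m * L * ∣ restrict adj? A a j ∣) →
        ∏ (λ j → ∣ restrict adj? A a j ∣) ≤ D * #embeddings (λ x y → adj? (suc x) (suc y)) (restrict adj? A a)) →
      ∏ (λ x → ∣ A x ∣) ≤ 2 * (D * m ^ h) * #embeddings adj? A
    #embeddings-step {D} rest = begin
      ∣ A zero ∣ * Π                                  ≤⟨ ℕ.*-monoˡ-≤ Π half-typical ⟩
      2 * #typical * Π                                ≡⟨ ℕ.*-assoc 2 #typical Π ⟩
      2 * (#typical * Π)                              ≡⟨ cong (2 *_) (*-distribʳ-sum Π (λ a → 𝟙∈ (A zero) a * 𝟙 (allTypical? a))) ⟩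
      2 * ∑ (λ a → 𝟙∈ (A zero) a * 𝟙 (allTypical? a) * Π)
        ≤⟨ ℕ.*-monoʳ-≤ 2 (∑-mono pointwise) ⟩
      2 * ∑ (λ a → D * m ^ h * (𝟙∈ (A zero) a * N a))
        ≡⟨ cong (2 *_) (*-distribˡ-sum (D * m ^ h) (λ a → 𝟙∈ (A zero) a * N a)) ⟨
      2 * (D * m ^ h * ∑ (λ a → 𝟙∈ (A zero) a * N a))
        ≡⟨ cong (λ z → 2 * (D * m ^ h * z)) (#embeddings-suc adj? A) ⟨
      2 * (D * m ^ h * #embeddings adj? A)            ≡⟨ ℕ.*-assoc 2 (D * m ^ h) _ ⟨
      2 * (D * m ^ h) * #embeddings adj? A            ∎
      where
      open ℕ.≤-Reasoning
      Π = ∏ (λ j → ∣ A (suc j) ∣)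
      N : Fin n → ℕ
      N a = #embeddings (λ x y → adj? (suc x) (suc y)) (restrict adj? A a)
      pointwise : ∀ a → 𝟙∈ (A zero) a * 𝟙 (allTypical? a) * Π ≤ D * m ^ h * (𝟙∈ (A zero) a * N a)
      pointwise a = cases (a ∈? A zero) (allTypical? a)
        where
        cases : (p? : Dec (a ∈ A zero)) (q? : Dec (∀ j → Typical a j)) → 𝟙 p? * 𝟙 q? * Π ≤ D * m ^ h * (𝟙 p? * N a)
        cases (no _)  _       = z≤n
        cases (yes _) (no _)  = z≤n
        cases (yes _) (yes typ) = begin
            Π + 0                                              ≡⟨ ℕ.+-identityʳ Π ⟩
            Π                                                  ≤⟨ ∏-scale m typ ⟩
            m ^ h * ∏ (λ j → ∣ restrict adj? A a j ∣)          ≤⟨ ℕ.*-monoʳ-≤ (m ^ h) (rest a λ j → ℕ.≤-trans (B≤LA (suc j))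
                (ℕ.≤-trans (ℕ.*-monoʳ-≤ L (typ j)) (ℕ.≤-reflexive
                  (solve 3 (λ L m z → L :* (m :* z) := m :* L :* z) refl L m ∣ restrict adj? A a j ∣)))) ⟩
            m ^ h * (D * N a)                                  ≡⟨ solve 3 (λ m D z → m :* (D :* z) := D :* m :* (z :+ con 0)) refl (m ^ h) D (N a) ⟩
            D * m ^ h * (N a + 0)                              ∎

  -- The classes A shrink during the induction while the sizes B, relative to
  -- which density is required, stay fixed; L bounds the total shrinking.
  count-embeddings : ∀ h {Adj : Fin h → Fin h → Set} (adj? : ∀ x y → Dec (Adj x y)) {m c M L} →
    0 < m → m ≤ 2 * c → 0 < L → (A : Fin h → Subset n) (B : Fin h → ℕ) →
    2 * (h * (m ^ h * L)) ≤ M → (∀ x → B x ≤ L * ∣ A x ∣) →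
    (∀ x y → x Fin.< y → Adj x y → DensePair m M (B x) (B y) (A x) (A y)) →
    ∏ (λ x → ∣ A x ∣) ≤ 1/δ h c * #embeddings adj? A
  count-embeddings zero adj? _ _ _ A B _ _ _ =
    ℕ.≤-reflexive (sym (trans (ℕ.*-identityˡ _) (#embeddings-zero adj? A)))
  -- One vertex is treated separately: here nothing is lost, whereas the general step would cost a
  -- factor 2.
  count-embeddings (suc zero) adj? _ _ _ A B _ _ _ = ℕ.≤-reflexive (begin
    ∣ A zero ∣ * 1                                ≡⟨ ℕ.*-identityʳ _ ⟩
    ∣ A zero ∣                                    ≡⟨ ∣∣≡∑ (A zero) ⟩
    ∑ (𝟙∈ (A zero))                               ≡⟨ sum-cong-≗ (λ a → ℕ.*-identityʳ (𝟙∈ (A zero) a)) ⟨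
    ∑ (λ a → 𝟙∈ (A zero) a * 1)                   ≡⟨ sum-cong-≗ (λ a → cong (𝟙∈ (A zero) a *_) (#embeddings-zero (λ x y → adj? (suc x) (suc y)) (restrict adj? A a))) ⟨
    _                                             ≡⟨ #embeddings-suc adj? A ⟨
    #embeddings adj? A                            ≡⟨ ℕ.*-identityˡ _ ⟨
    1 * #embeddings adj? A                        ∎)
    where open ≡-Reasoning
  count-embeddings (suc (suc h)) adj? {m} {c} {M} {L} 0<m m≤2c 0<L A B L≤M B≤LA dense = ℕ.≤-trans
    (#embeddings-step adj? 0<m 0<L A B L≤M B≤LA dense {1/δ (suc h) (2 * c)} λ a B≤ →
      count-embeddings (suc h) (λ x y → adj? (suc x) (suc y)) {m} {2 * c} {M} {m * L} 0<m (ℕ.≤-trans m≤2c (ℕ.m≤n*m (2 * c) 2)) (ℕ.*-mono-≤ {1} 0<m 0<L)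
        (restrict adj? A a) (B ∘ suc) L′≤M B≤
        λ x y x<y adj S T S⊆ T⊆ → dense (suc x) (suc y) (s≤s x<y) adj S T
          (restrict-⊆ adj? A a x ∘ S⊆) (restrict-⊆ adj? A a y ∘ T⊆))
    -- The required density `1 / m` stays constant, while the recursion of `δ` halves d at every
    -- level; `m ≤ 2 * c` reconciles the two.
    (ℕ.*-monoˡ-≤ (#embeddings adj? A) (ℕ.*-monoʳ-≤ 2 (ℕ.*-monoʳ-≤ (1/δ (suc h) (2 * c)) (ℕ.^-monoˡ-≤ (suc h) m≤2c))))
    where
    -- One factor `m` moves from the power into the shrinking bound, so the condition on `M` is
    -- inherited.
    L′≤M : 2 * (suc h * (m ^ suc h * (m * L))) ≤ M
    L′≤M = ℕ.≤-trans (ℕ.*-monoʳ-≤ 2 (ℕ.*-mono-≤ (ℕ.n≤1+n (suc h)) (ℕ.≤-reflexive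
      (solve 3 (λ p m L → p :* (m :* L) := (m :* p) :* L) refl (m ^ suc h) m L)))) L≤M

-- Reduced copies and the copies arising from them

-- `funToFin` inverts `finToFun` and depends on the values of its argument only.
finToFun-injective : ∀ {m n} (k l : Fin (m ^ n)) → (∀ j → finToFun {m} {n} k j ≡ finToFun l j) → k ≡ l
finToFun-injective {m} {n} k l eq = begin
  k                                 ≡⟨ Fin.funToFin-finToFin {n} {m} k ⟨
  funToFin (finToFun {m} {n} k)     ≡⟨ funToFin-cong n eq ⟩
  funToFin (finToFun {m} {n} l)     ≡⟨ Fin.funToFin-finToFin {n} {m} l ⟩
  l                                 ∎
  where
  open ≡-Reasoning
  funToFin-cong : ∀ n {f g : Fin n → Fin m} → (∀ j → f j ≡ g j) → funToFin f ≡ funToFin g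
  funToFin-cong zero    f≗g = refl
  funToFin-cong (suc n) f≗g = cong₂ combine (f≗g zero) (funToFin-cong n (f≗g ∘ suc))

increasing⇒injective : ∀ {h n} {f : Fin h → Fin n} → Increasing f → ∀ {x y} → f x ≡ f y → x ≡ y
increasing⇒injective inc {x} {y} eq with Fin.<-cmp x y
... | tri< x<y _ _ = contradiction eq (Fin.<⇒≢ (inc x y x<y))
... | tri≈ _ x≡y _ = x≡y
... | tri> _ _ y<x = contradiction (sym eq) (Fin.<⇒≢ (inc y x y<x))

-- With K = PB, the upper bound applied to the whole pair gives k / K ≥ 1 / c - 1 / P. The lower
-- bound then gives (S, T) density at least 1 / c - 2 / P, which is at least 1 / (2c) because P ≥
-- 4c.
dense-of-concentrated : ∀ {n c M P} {r : Fin n → Fin n → ℕ} {X Y} → 0 < M → 4 * c ≤ P → 0 < P →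
  0 < ∣ X ∣ * ∣ Y ∣ → Concentrated r M P X Y → ∣ X ∣ * ∣ Y ∣ ≤ c * edges r X Y →
  ∀ S T → S ⊆ X → T ⊆ Y → ∣ X ∣ ≤ M * ∣ S ∣ → ∣ Y ∣ ≤ M * ∣ T ∣ → ∣ S ∣ * ∣ T ∣ ≤ 2 * c * edges r S T
dense-of-concentrated {c = c} {M} {P} {r} {X} {Y} 0<M 4c≤P 0<P 0<xy conc dense S T S⊆X T⊆Y X≤MS Y≤MT =
  ℕ.*-cancelˡ-≤ K (ℕ.+-cancelʳ-≤ (K * st) _ _ (begin
    K * st + K * st
      ≡⟨ solve 2 (λ K w → K :* w :+ K :* w := con 2 :* K :* w) refl K st ⟩
    2 * K * st
      ≤⟨ ℕ.*-monoˡ-≤ st (ℕ.*-monoʳ-≤ 2 K≤) ⟩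
    2 * (c * (k + B)) * st
      ≡⟨ solve 4 (λ c k B w → con 2 :* (c :* (k :+ B)) :* w := con 2 :* c :* (k :* w) :+ con 2 :* c :* (B :* w)) refl c k B st ⟩
    2 * c * (k * st) + 2 * c * (B * st)
      ≤⟨ ℕ.+-monoˡ-≤ (2 * c * (B * st)) (ℕ.*-monoʳ-≤ (2 * c) (above S T S⊆X T⊆Y X≤MS Y≤MT)) ⟩
    2 * c * (K * edges r S T + B * st) + 2 * c * (B * st)
      ≡⟨ solve 5 (λ c K e B w → con 2 :* c :* (K :* e :+ B :* w) :+ con 2 :* c :* (B :* w)
           := K :* (con 2 :* c :* e) :+ con 4 :* c :* B :* w) refl c K (edges r S T) B st ⟩
    K * (2 * c * edges r S T) + 4 * c * B * st
      ≤⟨ ℕ.+-monoʳ-≤ (K * (2 * c * edges r S T)) (ℕ.*-monoˡ-≤ st (ℕ.*-monoˡ-≤ B 4c≤P)) ⟩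
    K * (2 * c * edges r S T) + K * st ∎))
  where
  open ℕ.≤-Reasoning
  open Concentrated conc
  st = ∣ S ∣ * ∣ T ∣
  xy = ∣ X ∣ * ∣ Y ∣
  K = P * B
  instance
    _ = ℕ.>-nonZero (ℕ.*-mono-≤ {1} 0<P B>0)
    _ = ℕ.>-nonZero 0<xy
    _ = ℕ.>-nonZero 0<M
  K≤ : K ≤ c * (k + B)
  K≤ = ℕ.*-cancelʳ-≤ K (c * (k + B)) xy (begin
    K * xy                    ≤⟨ ℕ.*-monoʳ-≤ K dense ⟩
    K * (c * edges r X Y)     ≡⟨ solve 3 (λ K c e → K :* (c :* e) := c :* (K :* e)) refl K c (edges r X Y) ⟩
    c * (K * edges r X Y)     ≤⟨ ℕ.*-monoʳ-≤ c (below X Y id id (ℕ.m≤n*m _ M) (ℕ.m≤n*m _ M)) ⟩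
    c * (k * xy + B * xy)     ≡⟨ solve 4 (λ c k B w → c :* (k :* w :+ B :* w) := c :* (k :+ B) :* w) refl c k B xy ⟩
    c * (k + B) * xy          ∎)

≺-disjoint : ∀ {n t} {W : Fin t → Subset n} → (∀ a b → a Fin.< b → W a ≺ W b) →
  ∀ {a u v} → a ∈ W u → a ∈ W v → u ≡ v
≺-disjoint ordered {a} {u} {v} a∈u a∈v with Fin.<-cmp u v
... | tri< u<v _ _ = contradiction (ordered u v u<v a∈u a∈v) (Fin.<-irrefl refl)
... | tri≈ _ u≡v _ = u≡v
... | tri> _ _ v<u = contradiction (ordered v u v<u a∈v a∈u) (Fin.<-irrefl refl)

module _ {n c : ℕ} (χ : Coloring n c) where

  colored : Fin c → Fin n → Fin n → ℕ
  colored γ a b = 𝟙 (hasColor? χ γ a b)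

  edgesBetween≡edges : ∀ γ A B → edgesBetween χ γ A B ≡ edges (colored γ) A B
  edgesBetween≡edges γ A B = begin
    edgesBetween χ γ A B
      ≡⟨ length-filter (inPair? χ γ A B) (cartesianProduct (allFin n) (allFin n)) ⟩
    Σₗ (map (λ p → 𝟙 (inPair? χ γ A B p)) (cartesianProduct (allFin n) (allFin n)))
      ≡⟨ Σₗ-cartesianProduct (λ p → 𝟙 (inPair? χ γ A B p)) (allFin n) (allFin n) ⟩
    Σₗ (map (λ a → Σₗ (map (λ b → 𝟙 (inPair? χ γ A B (a , b))) (allFin n))) (allFin n))
      ≡⟨ Σₗ-allFin (λ a → Σₗ (map (λ b → 𝟙 (inPair? χ γ A B (a , b))) (allFin n))) ⟩
    ∑ (λ a → Σₗ (map (λ b → 𝟙 (inPair? χ γ A B (a , b))) (allFin n)))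
      ≡⟨ sum-cong-≗ (λ a → Σₗ-allFin (λ b → 𝟙 (inPair? χ γ A B (a , b)))) ⟩
    ∑ (λ a → ∑ λ b → 𝟙 (inPair? χ γ A B (a , b)))
      ≡⟨ sum-cong-≗ (λ a → sum-cong-≗ λ b → trans
           (𝟙-× (a ∈? A) ((b ∈? B) ×-dec hasColor? χ γ a b))
           (cong (𝟙∈ A a *_) (𝟙-× (b ∈? B) (hasColor? χ γ a b)))) ⟩
    edges (colored γ) A B ∎
    where open ≡-Reasoning

  complete : ∀ {A B} → A ≺ B → ∣ A ∣ * ∣ B ∣ ≤ ∑ λ γ → edges (colored γ) A B
  complete {A} {B} A≺B = begin
    ∣ A ∣ * ∣ B ∣                        ≡⟨ cong₂ _*_ (∣∣≡∑ A) (∣∣≡∑ B) ⟩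
    ∑ (𝟙∈ A) * ∑ (𝟙∈ B)                 ≡⟨ *-distribʳ-sum (∑ (𝟙∈ B)) (𝟙∈ A) ⟩
    ∑ (λ a → 𝟙∈ A a * ∑ (𝟙∈ B))         ≡⟨ sum-cong-≗ (λ a → *-distribˡ-sum (𝟙∈ A a) (𝟙∈ B)) ⟩
    ∑ (λ a → ∑ λ b → 𝟙∈ A a * 𝟙∈ B b)   ≤⟨ ∑-mono (λ a → ∑-mono λ b → pointwise a b) ⟩
    ∑ (λ a → ∑ λ b → ∑ λ γ → 𝟙∈ A a * (𝟙∈ B b * colored γ a b))
      ≡⟨ sum-cong-≗ (λ a → ∑-comm (λ b γ → 𝟙∈ A a * (𝟙∈ B b * colored γ a b))) ⟩
    ∑ (λ a → ∑ λ γ → ∑ λ b → 𝟙∈ A a * (𝟙∈ B b * colored γ a b))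
      ≡⟨ ∑-comm (λ a γ → ∑ λ b → 𝟙∈ A a * (𝟙∈ B b * colored γ a b)) ⟩
    ∑ (λ γ → edges (colored γ) A B) ∎
    where
    open ℕ.≤-Reasoning
    pointwise : ∀ a b → 𝟙∈ A a * 𝟙∈ B b ≤ ∑ λ γ → 𝟙∈ A a * (𝟙∈ B b * colored γ a b)
    pointwise a b with a ∈? A | b ∈? B
    ... | no _    | _       = z≤n
    ... | yes _   | no _    = z≤n
    ... | yes a∈A | yes b∈B = ℕ.≤-trans
      (ℕ.≤-reflexive (sym (trans (ℕ.*-identityˡ _) (trans (ℕ.*-identityˡ _)
        (𝟙-yes (hasColor? χ (χ a b (A≺B a∈A b∈B)) a b) (inj₁ (A≺B a∈A b∈B , refl)))))))
      (∑-≥-term (λ γ → 1 * (1 * colored γ a b)) (χ a b (A≺B a∈A b∈B)))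

  -- Averaging over the `c` colours, since every pair between A and B has some colour.
  densest : ∀ {A B} → A ≺ B → ∀ γ → (∀ γ′ → edges (colored γ′) A B ≤ edges (colored γ) A B) →
    ∣ A ∣ * ∣ B ∣ ≤ c * edges (colored γ) A B
  densest {A} {B} A≺B γ max = begin
    ∣ A ∣ * ∣ B ∣                            ≤⟨ complete A≺B ⟩
    ∑ (λ γ′ → edges (colored γ′) A B)        ≤⟨ ∑-mono max ⟩
    ∑ {c} (λ _ → edges (colored γ) A B)      ≡⟨ ∑-const c (edges (colored γ) A B) ⟩
    c * edges (colored γ) A B                ∎
    where open ℕ.≤-Reasoning

  module _ {t : ℕ} (W : Fin t → Subset n) (ordered : ∀ a b → a Fin.< b → W a ≺ W b)
           (ρ : Coloring t c) (i : Fin c) (H : OrderedGraph) where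

    private
      h = v H

      reduced : Fin (t ^ h) → Fin h → Fin t
      reduced = finToFun

      embed? : ∀ F f → Dec (Embedding (hasColor? χ i) (adj? H) (W ∘ F) f)
      embed? F = embedding? (hasColor? χ i) (adj? H) (W ∘ F)

      module _ {F : Fin h → Fin t} {f : Fin h → Fin n} (mono : IsMonoCopy ρ i H F)
               (emb : Embedding (hasColor? χ i) (adj? H) (W ∘ F) f) where

        embedding-monoCopy : IsMonoCopy χ i H f
        embedding-monoCopy = (λ x y x<y → ordered (F x) (F y) (proj₁ mono x y x<y) (proj₁ emb x) (proj₁ emb y)) , col
          where
          col : ∀ x y → Adj H x y → HasColor χ i (f x) (f y)
          col x y adj with Fin.<-cmp x y
          ... | tri< x<y _ _ = proj₂ emb x y x<y adj
          ... | tri≈ _ x≡y _ = contradiction adj (irrefl H x≡y)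
          ... | tri> _ _ y<x = swap (proj₂ emb y x y<x (symm H adj))

        embedding-transversal : Transversal W f
        embedding-transversal j x y fx∈ fy∈ = increasing⇒injective (proj₁ mono)
          (trans (≺-disjoint ordered (proj₁ emb x) fx∈) (≺-disjoint ordered fy∈ (proj₁ emb y)))

      isRegCopy-embedding : ∀ (K : Fin (t ^ h)) {f} → IsMonoCopy ρ i H (reduced K) →
        Embedding (hasColor? χ i) (adj? H) (W ∘ reduced K) f → IsRegCopy χ W ρ i H f
      isRegCopy-embedding K mono emb =
        lose (∈-filter⁺ (isMonoCopy? ρ i H) (∈-map⁺ reduced (∈-allFin K)) mono) (proj₁ emb)
        , embedding-transversal mono emb

      clusterVolume≡ : clusterVolume χ W ρ i H ≡
        ∑ λ (K : Fin (t ^ h)) → 𝟙 (isMonoCopy? ρ i H (reduced K)) * ∏ (λ ℓ → ∣ W (reduced K ℓ) ∣)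
      clusterVolume≡ = trans (Σₗ-filter (isMonoCopy? ρ i H) _ (maps h t)) (trans (Σₗ-maps h t _)
        (sum-cong-≗ λ K → cong (𝟙 (isMonoCopy? ρ i H (reduced K)) *_) (∏-allFin (λ ℓ → ∣ W (reduced K ℓ) ∣))))

      #regCopies≡ : #regCopies χ W ρ i H ≡
        ∑ λ (k : Fin (n ^ h)) → 𝟙 (isMonoCopy? χ i H (finToFun k) ×-dec isRegCopy? χ W ρ i H (finToFun k))
      #regCopies≡ = trans (length-filter (isRegCopy? χ W ρ i H) (monoCopies χ i H))
        (trans (Σₗ-filter (isMonoCopy? χ i H) _ (maps h n)) (trans (Σₗ-maps h n _)
          (sum-cong-≗ λ k → sym (𝟙-× (isMonoCopy? χ i H (finToFun k)) (isRegCopy? χ W ρ i H (finToFun k))))))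

    -- Double counting of pairs consisting of a reduced copy and an embedding into its clusters. By
    -- disjointness each vertex of an embedded copy determines its cluster, so `∑-𝟙-unique` applies
    -- once the order of summation is exchanged.
    clusterVolume-≤ : ∀ {D} →
      (∀ F → IsMonoCopy ρ i H F → ∏ (λ ℓ → ∣ W (F ℓ) ∣) ≤ D * #embeddings (hasColor? χ i) (adj? H) (W ∘ F)) →
      clusterVolume χ W ρ i H ≤ D * #regCopies χ W ρ i H
    clusterVolume-≤ {D} count = begin
      clusterVolume χ W ρ i H
        ≡⟨ clusterVolume≡ ⟩
      ∑ (λ (K : Fin (t ^ h)) → 𝟙 (isMonoCopy? ρ i H (reduced K)) * ∏ (λ ℓ → ∣ W (reduced K ℓ) ∣))
        ≤⟨ ∑-mono (λ K → pointwise (reduced K) (isMonoCopy? ρ i H (reduced K))) ⟩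
      ∑ (λ (K : Fin (t ^ h)) → D * ∑ λ (k : Fin (n ^ h)) → both K k)
        ≡⟨ *-distribˡ-sum D (λ (K : Fin (t ^ h)) → ∑ λ (k : Fin (n ^ h)) → both K k) ⟨
      D * ∑ (λ (K : Fin (t ^ h)) → ∑ λ (k : Fin (n ^ h)) → both K k)
        ≡⟨ cong (D *_) (∑-comm both) ⟩
      D * ∑ (λ (k : Fin (n ^ h)) → ∑ λ (K : Fin (t ^ h)) → both K k)
        ≤⟨ ℕ.*-monoʳ-≤ D (∑-mono λ k → ∑-𝟙-unique
             (λ K → isMonoCopy? ρ i H (reduced K) ×-dec embed? (reduced K) (finToFun k))
             (isMonoCopy? χ i H (finToFun k) ×-dec isRegCopy? χ W ρ i H (finToFun k))
             (λ K (mono , emb) → embedding-monoCopy mono emb , isRegCopy-embedding K mono emb)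
             (λ K L (_ , embK) (_ , embL) → finToFun-injective {t} {h} K L
               λ j → ≺-disjoint ordered (proj₁ embK j) (proj₁ embL j))) ⟩
      D * ∑ (λ (k : Fin (n ^ h)) → 𝟙 (isMonoCopy? χ i H (finToFun k) ×-dec isRegCopy? χ W ρ i H (finToFun k)))
        ≡⟨ cong (D *_) #regCopies≡ ⟨
      D * #regCopies χ W ρ i H ∎
      where
      open ℕ.≤-Reasoning
      both : Fin (t ^ h) → Fin (n ^ h) → ℕ
      both K k = 𝟙 (isMonoCopy? ρ i H (reduced K) ×-dec embed? (reduced K) (finToFun k))
      pointwise : ∀ F (mono? : Dec (IsMonoCopy ρ i H F)) →
        𝟙 mono? * ∏ (λ ℓ → ∣ W (F ℓ) ∣) ≤ D * ∑ λ (k : Fin (n ^ h)) → 𝟙 (mono? ×-dec embed? F (finToFun k))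
      pointwise F (no _)     = z≤n
      pointwise F (yes mono) = ℕ.≤-trans (ℕ.≤-reflexive (ℕ.*-identityˡ _)) (count F mono)

    clusterVolume-≤-#regCopies : ∀ {M P} → 0 < c → 2 * (h * ((2 * c) ^ h)) ≤ M → 0 < M → 4 * c ≤ P →
      (∀ j → 0 < ∣ W j ∣) →
      (∀ a b → a Fin.< b → Concentrated (colored i) M P (W a) (W b)) →
      (∀ a b .(a<b : a Fin.< b) → ∣ W a ∣ * ∣ W b ∣ ≤ c * edges (colored (ρ a b a<b)) (W a) (W b)) →
      clusterVolume χ W ρ i H ≤ 1/δ h c * #regCopies χ W ρ i H
    clusterVolume-≤-#regCopies {M} {P} 0<c hc≤M 0<M 4c≤P W>0 conc dense = clusterVolume-≤ {1/δ h c} λ F (inc , col) →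
      -- At the start nothing has shrunk: the reference sizes are the cluster sizes and `L` is 1.
      -- The density `1 / (2 * c)` is the one from `dense-of-concentrated`.
      count-embeddings (hasColor? χ i) h (adj? H) {2 * c} {c} {M} {1} (ℕ.*-mono-≤ {1} {2} (s≤s z≤n) 0<c) ℕ.≤-refl (s≤s z≤n)
        (W ∘ F) (λ ℓ → ∣ W (F ℓ) ∣)
        (subst (λ z → 2 * (h * z) ≤ M) (sym (ℕ.*-identityʳ ((2 * c) ^ h))) hc≤M)
        (λ ℓ → ℕ.≤-reflexive (sym (ℕ.*-identityˡ _)))
        λ x y x<y adj → dense-of-concentrated {c = c} 0<M 4c≤P (ℕ.≤-trans (ℕ.*-mono-≤ {1} {4} (s≤s z≤n) 0<c) 4c≤P)
          (ℕ.*-mono-≤ {1} (W>0 (F x)) (W>0 (F y))) (conc (F x) (F y) (inc x y x<y)) (denseᵢ (inc x y x<y) (col x y adj))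
      where
      denseᵢ : ∀ {a b} → a Fin.< b → HasColor ρ i a b → ∣ W a ∣ * ∣ W b ∣ ≤ c * edges (colored i) (W a) (W b)
      denseᵢ {a} {b} a<b (inj₁ (_ , refl)) = dense a b a<b
      denseᵢ a<b (inj₂ (b<a , _)) = contradiction b<a (ℕ.<-asym a<b)

-- Rational arithmetic

toℚᵘ-fromℕ : ∀ n → ℚ.toℚᵘ (fromℕ n) ℚᵘ.≃ ℚᵘ.mkℚᵘ (ℤ.+ n) 0
toℚᵘ-fromℕ n = ℚ.toℚᵘ-fromℚᵘ (ℚᵘ.mkℚᵘ (ℤ.+ n) 0)

fromℕ-+ : ∀ m n → fromℕ (m + n) ≡ fromℕ m ℚ.+ fromℕ n
fromℕ-+ m n = ℚ.toℚᵘ-injective (begin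
  ℚ.toℚᵘ (fromℕ (m + n))                                  ≈⟨ toℚᵘ-fromℕ (m + n) ⟩
  ℚᵘ.mkℚᵘ (ℤ.+ (m + n)) 0                                   ≈⟨ ℚᵘ.*≡* (cong (ℤ._* ℤ.+ 1)
    (sym (cong₂ ℤ._+_ (ℤ.*-identityʳ (ℤ.+ m)) (ℤ.*-identityʳ (ℤ.+ n))))) ⟩
  ℚᵘ.mkℚᵘ (ℤ.+ m) 0 ℚᵘ.+ ℚᵘ.mkℚᵘ (ℤ.+ n) 0                    ≈⟨ ℚᵘ.+-cong (toℚᵘ-fromℕ m) (toℚᵘ-fromℕ n) ⟨
  ℚ.toℚᵘ (fromℕ m) ℚᵘ.+ ℚ.toℚᵘ (fromℕ n)                  ≈⟨ ℚ.toℚᵘ-homo-+ (fromℕ m) (fromℕ n) ⟨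
  ℚ.toℚᵘ (fromℕ m ℚ.+ fromℕ n)                            ∎)
  where open ℚᵘ.≃-Reasoning

fromℕ-* : ∀ m n → fromℕ (m * n) ≡ fromℕ m ℚ.* fromℕ n
fromℕ-* m n = ℚ.toℚᵘ-injective (begin
  ℚ.toℚᵘ (fromℕ (m * n))                                  ≈⟨ toℚᵘ-fromℕ (m * n) ⟩
  ℚᵘ.mkℚᵘ (ℤ.+ (m * n)) 0                                   ≈⟨ ℚᵘ.*≡* (cong (ℤ._* ℤ.+ 1) (ℤ.pos-* m n)) ⟩
  ℚᵘ.mkℚᵘ (ℤ.+ m) 0 ℚᵘ.* ℚᵘ.mkℚᵘ (ℤ.+ n) 0                    ≈⟨ ℚᵘ.*-cong (toℚᵘ-fromℕ m) (toℚᵘ-fromℕ n) ⟨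
  ℚ.toℚᵘ (fromℕ m) ℚᵘ.* ℚ.toℚᵘ (fromℕ n)                  ≈⟨ ℚ.toℚᵘ-homo-* (fromℕ m) (fromℕ n) ⟨
  ℚ.toℚᵘ (fromℕ m ℚ.* fromℕ n)                            ∎)
  where open ℚᵘ.≃-Reasoning

fromℕ-^ : ∀ m k → fromℕ (m ^ k) ≡ fromℕ m ^ℚ k
fromℕ-^ m zero    = refl
fromℕ-^ m (suc k) = trans (fromℕ-* m (m ^ k)) (cong (fromℕ m ℚ.*_) (fromℕ-^ m k))

fromℕ-mono-≤ : ∀ {m n} → m ≤ n → fromℕ m ℚ.≤ fromℕ n
fromℕ-mono-≤ {m} {n} m≤n = ℚ.toℚᵘ-cancel-≤ (begin
  ℚ.toℚᵘ (fromℕ m)     ≃⟨ toℚᵘ-fromℕ m ⟩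
  ℚᵘ.mkℚᵘ (ℤ.+ m) 0      ≤⟨ ℚᵘ.*≤* (ℤ.*-monoʳ-≤-nonNeg (ℤ.+ 1) (ℤ.+≤+ m≤n)) ⟩
  ℚᵘ.mkℚᵘ (ℤ.+ n) 0      ≃⟨ toℚᵘ-fromℕ n ⟨
  ℚ.toℚᵘ (fromℕ n)     ∎)
  where open ℚᵘ.≤-Reasoning

fromℕ-cancel-≤ : ∀ {m n} → fromℕ m ℚ.≤ fromℕ n → m ≤ n
fromℕ-cancel-≤ {m} {n} m≤n with (begin
  ℚᵘ.mkℚᵘ (ℤ.+ m) 0      ≃⟨ toℚᵘ-fromℕ m ⟨
  ℚ.toℚᵘ (fromℕ m)     ≤⟨ ℚ.toℚᵘ-mono-≤ m≤n ⟩
  ℚ.toℚᵘ (fromℕ n)     ≃⟨ toℚᵘ-fromℕ n ⟩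
  ℚᵘ.mkℚᵘ (ℤ.+ n) 0      ∎)
  where open ℚᵘ.≤-Reasoning
... | ℚᵘ.*≤* le = ℤ.drop‿+≤+ (ℤ.*-cancelʳ-≤-pos (ℤ.+ m) (ℤ.+ n) (ℤ.+ 1) le)

fromℕ-nonNegative : ∀ n → ℚ.NonNegative (fromℕ n)
fromℕ-nonNegative n = ℚ.nonNegative (fromℕ-mono-≤ {0} {n} z≤n)

fromℕ-positive : ∀ {n} → 0 < n → ℚ.Positive (fromℕ n)
fromℕ-positive {n} 0<n = ℚ.positive (ℚ.<-≤-trans (ℚ.positive⁻¹ 1ℚ) (fromℕ-mono-≤ {1} {n} 0<n))

-- Positivity of `q` excludes the default value of `÷₀`.
÷₀-* : ∀ p q .{{_ : ℚ.Positive q}} → (p ÷₀ q) ℚ.* q ≡ p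
÷₀-* p q with q ℚ.≟ 0ℚ
÷₀-* p q | yes refl = contradiction (ℚ.positive⁻¹ 0ℚ) (ℚ.<-irrefl refl)
... | no q≢0 = trans (ℚ.*-assoc p _ q) (trans (cong (p ℚ.*_) (ℚ.*-inverseˡ q {{ℚ.≢-nonZero q≢0}})) (ℚ.*-identityʳ p))

-- The constants ε, α, 1 / c and δ_i are all reciprocals of natural numbers, so inequalities
-- involving them translate into inequalities in ℕ.
record IsReciprocal (x : ℚ) (m : ℕ) : Set where
  constructor isReciprocal
  field inverse : x ℚ.* fromℕ m ≡ 1ℚ

open IsReciprocal

÷₀-reciprocal : ∀ {m} → 0 < m → IsReciprocal (1ℚ ÷₀ fromℕ m) m
÷₀-reciprocal {m} 0<m = isReciprocal (÷₀-* 1ℚ (fromℕ m) {{fromℕ-positive 0<m}})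

reciprocal⇒positive : ∀ {x m} → IsReciprocal x m → ℚ.Positive x
reciprocal⇒positive {x} {m} eq = ℚ.positive (ℚ.≰⇒> {x} {0ℚ} λ x≤0 → ℚ.<-irrefl refl (ℚ.<-≤-trans (ℚ.positive⁻¹ 1ℚ) (begin
  1ℚ               ≡⟨ inverse eq ⟨
  x ℚ.* fromℕ m    ≤⟨ ℚ.*-monoʳ-≤-nonNeg (fromℕ m) {{fromℕ-nonNegative m}} x≤0 ⟩
  0ℚ ℚ.* fromℕ m   ≡⟨ ℚ.*-zeroˡ (fromℕ m) ⟩
  0ℚ               ∎)))
  where open ℚ.≤-Reasoning

^ℚ-distrib-* : ∀ p q k → (p ℚ.* q) ^ℚ k ≡ p ^ℚ k ℚ.* q ^ℚ k
^ℚ-distrib-* p q zero    = refl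
^ℚ-distrib-* p q (suc k) = trans (cong ((p ℚ.* q) ℚ.*_) (^ℚ-distrib-* p q k))
  (solveℚ 4 (λ p q x y → p ⊗ q ⊗ (x ⊗ y) ≐ p ⊗ x ⊗ (q ⊗ y)) refl p q (p ^ℚ k) (q ^ℚ k))

1^ℚ : ∀ k → 1ℚ ^ℚ k ≡ 1ℚ
1^ℚ zero    = refl
1^ℚ (suc k) = trans (ℚ.*-identityˡ (1ℚ ^ℚ k)) (1^ℚ k)

^ℚ-reciprocal : ∀ {x m} → IsReciprocal x m → ∀ k → IsReciprocal (x ^ℚ k) (m ^ k)
^ℚ-reciprocal {x} {m} eq k = isReciprocal (begin
  x ^ℚ k ℚ.* fromℕ (m ^ k)    ≡⟨ cong (x ^ℚ k ℚ.*_) (fromℕ-^ m k) ⟩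
  x ^ℚ k ℚ.* fromℕ m ^ℚ k     ≡⟨ ^ℚ-distrib-* x (fromℕ m) k ⟨
  (x ℚ.* fromℕ m) ^ℚ k        ≡⟨ cong (_^ℚ k) (inverse eq) ⟩
  1ℚ ^ℚ k                     ≡⟨ 1^ℚ k ⟩
  1ℚ                          ∎)
  where open ≡-Reasoning

*-reciprocal : ∀ {x y m n} → IsReciprocal x m → IsReciprocal y n → IsReciprocal (x ℚ.* y) (m * n)
*-reciprocal {x} {y} {m} {n} xm≡1 yn≡1 = isReciprocal (begin
  x ℚ.* y ℚ.* fromℕ (m * n)               ≡⟨ cong (x ℚ.* y ℚ.*_) (fromℕ-* m n) ⟩
  x ℚ.* y ℚ.* (fromℕ m ℚ.* fromℕ n)       ≡⟨ solveℚ 4 (λ x y m n → x ⊗ y ⊗ (m ⊗ n) ≐ x ⊗ m ⊗ (y ⊗ n)) refl x y (fromℕ m) (fromℕ n) ⟩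
  x ℚ.* fromℕ m ℚ.* (y ℚ.* fromℕ n)       ≡⟨ cong₂ ℚ._*_ (inverse xm≡1) (inverse yn≡1) ⟩
  1ℚ                                      ∎)
  where open ≡-Reasoning

δ-reciprocal : ∀ h {d m} → IsReciprocal d m → IsReciprocal (δ h d) (1/δ h m)
δ-reciprocal zero          _  = isReciprocal refl
δ-reciprocal (suc zero)    _  = isReciprocal refl
δ-reciprocal (suc (suc h)) {d} {m} eq = subst (λ x → IsReciprocal x (1/δ (suc (suc h)) m))
  (sym (ℚ.*-assoc ½ (δ (suc h) (½ ℚ.* d)) ((½ ℚ.* d) ^ℚ suc h)))
  (*-reciprocal {½} {m = 2} (isReciprocal refl) (*-reciprocal (δ-reciprocal (suc h) half) (^ℚ-reciprocal half (suc h))))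
  where
  half : IsReciprocal (½ ℚ.* d) (2 * m)
  half = *-reciprocal {½} {m = 2} (isReciprocal refl) eq

reciprocal-* : ∀ {x m} → IsReciprocal x m → ∀ n → x ℚ.* fromℕ (m * n) ≡ fromℕ n
reciprocal-* {x} {m} eq n = trans (cong (x ℚ.*_) (fromℕ-* m n))
  (trans (sym (ℚ.*-assoc x (fromℕ m) (fromℕ n))) (trans (cong (ℚ._* fromℕ n) (inverse eq)) (ℚ.*-identityˡ (fromℕ n))))

reciprocal-≤ : ∀ {x m k n} → IsReciprocal x m → k ≤ m * n → x ℚ.* fromℕ k ℚ.≤ fromℕ n
reciprocal-≤ {x} {m} {k} {n} eq k≤mn = ℚ.≤-trans
  (ℚ.*-monoˡ-≤-nonNeg x {{ℚ.pos⇒nonNeg x {{reciprocal⇒positive eq}}}} (fromℕ-mono-≤ k≤mn))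
  (ℚ.≤-reflexive (reciprocal-* eq n))

reciprocal-≤⁻ : ∀ {x m k n} → IsReciprocal x m → x ℚ.* fromℕ k ℚ.≤ fromℕ n → k ≤ m * n
reciprocal-≤⁻ {x} {m} {k} {n} eq xk≤n = fromℕ-cancel-≤ (ℚ.*-cancelˡ-≤-pos x {{reciprocal⇒positive eq}}
  (ℚ.≤-trans xk≤n (ℚ.≤-reflexive (sym (reciprocal-* eq n)))))

0<factor : ∀ m {a x} → 0 < a → a ≤ m * x → 0 < x
0<factor m {x = zero}  0<a a≤mx = ℕ.≤-trans 0<a (ℕ.≤-trans a≤mx (ℕ.≤-reflexive (ℕ.*-zeroʳ m)))
0<factor m {x = suc _} _   _    = s≤s z≤n

∣p-q∣≤r : ∀ p q {r} → p ℚ.- q ℚ.≤ r → q ℚ.- p ℚ.≤ r → ℚ.∣ p ℚ.- q ∣ ℚ.≤ r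
∣p-q∣≤r p q {r} pq qp with ℚ.∣p∣≡p∨∣p∣≡-p (p ℚ.- q)
... | inj₁ eq = subst (ℚ._≤ r) (sym eq) pq
... | inj₂ eq = subst (ℚ._≤ r) (sym (trans eq (solveℚ 2 (λ p q → ⊖ (p ⊝ q) ≐ q ⊝ p) refl p q))) qp

-- Densities and ε-regularity

module _ {n c : ℕ} (χ : Coloring n c) where

  private
    size*size : ∀ (A B : Subset n) → fromℕ ∣ A ∣ ℚ.* fromℕ ∣ B ∣ ≡ fromℕ (∣ A ∣ * ∣ B ∣)
    size*size A B = sym (fromℕ-* ∣ A ∣ ∣ B ∣)

  density-* : ∀ γ A B → 0 < ∣ A ∣ * ∣ B ∣ →
    density χ γ A B ℚ.* fromℕ (∣ A ∣ * ∣ B ∣) ≡ fromℕ (edges (colored χ γ) A B)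
  density-* γ A B 0<AB = begin
    density χ γ A B ℚ.* fromℕ (∣ A ∣ * ∣ B ∣)
      ≡⟨ cong (λ z → (fromℕ (edgesBetween χ γ A B) ÷₀ z) ℚ.* fromℕ (∣ A ∣ * ∣ B ∣)) (size*size A B) ⟩
    (fromℕ (edgesBetween χ γ A B) ÷₀ fromℕ (∣ A ∣ * ∣ B ∣)) ℚ.* fromℕ (∣ A ∣ * ∣ B ∣)
      ≡⟨ ÷₀-* _ (fromℕ (∣ A ∣ * ∣ B ∣)) {{fromℕ-positive 0<AB}} ⟩
    fromℕ (edgesBetween χ γ A B)
      ≡⟨ cong fromℕ (edgesBetween≡edges χ γ A B) ⟩
    fromℕ (edges (colored χ γ) A B) ∎
    where open ≡-Reasoning

  density-≤⇒edges-≤ : ∀ γ γ′ A B → 0 < ∣ A ∣ * ∣ B ∣ → density χ γ A B ℚ.≤ density χ γ′ A B →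
    edges (colored χ γ) A B ≤ edges (colored χ γ′) A B
  density-≤⇒edges-≤ γ γ′ A B 0<AB d≤d′ = fromℕ-cancel-≤ (subst₂ ℚ._≤_ (density-* γ A B 0<AB) (density-* γ′ A B 0<AB)
    (ℚ.*-monoʳ-≤-nonNeg (fromℕ (∣ A ∣ * ∣ B ∣)) {{fromℕ-nonNegative (∣ A ∣ * ∣ B ∣)}} d≤d′))

  density-≤ : ∀ {K B k} γ X Y → 0 < ∣ X ∣ * ∣ Y ∣ →
    K * edges (colored χ γ) X Y ≤ k * (∣ X ∣ * ∣ Y ∣) + B * (∣ X ∣ * ∣ Y ∣) →
    fromℕ K ℚ.* density χ γ X Y ℚ.≤ fromℕ k ℚ.+ fromℕ B
  density-≤ {K} {B} {k} γ X Y 0<xy below = ℚ.*-cancelʳ-≤-pos (fromℕ xy) {{fromℕ-positive 0<xy}} (begin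
    fromℕ K ℚ.* density χ γ X Y ℚ.* fromℕ xy      ≡⟨ ℚ.*-assoc (fromℕ K) _ (fromℕ xy) ⟩
    fromℕ K ℚ.* (density χ γ X Y ℚ.* fromℕ xy)    ≡⟨ cong (fromℕ K ℚ.*_) (density-* γ X Y 0<xy) ⟩
    fromℕ K ℚ.* fromℕ (edges (colored χ γ) X Y)   ≡⟨ fromℕ-* K _ ⟨
    fromℕ (K * edges (colored χ γ) X Y)           ≤⟨ fromℕ-mono-≤ below ⟩
    fromℕ (k * xy + B * xy)                       ≡⟨ cong fromℕ (ℕ.*-distribʳ-+ xy k B) ⟨
    fromℕ ((k + B) * xy)                          ≡⟨ fromℕ-* (k + B) xy ⟩
    fromℕ (k + B) ℚ.* fromℕ xy                    ≡⟨ cong (ℚ._* fromℕ xy) (fromℕ-+ k B) ⟩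
    (fromℕ k ℚ.+ fromℕ B) ℚ.* fromℕ xy            ∎)
    where
    open ℚ.≤-Reasoning
    xy = ∣ X ∣ * ∣ Y ∣

  density-≥ : ∀ {K B k} γ X Y → 0 < ∣ X ∣ * ∣ Y ∣ →
    k * (∣ X ∣ * ∣ Y ∣) ≤ K * edges (colored χ γ) X Y + B * (∣ X ∣ * ∣ Y ∣) →
    fromℕ k ℚ.≤ fromℕ K ℚ.* density χ γ X Y ℚ.+ fromℕ B
  density-≥ {K} {B} {k} γ X Y 0<xy above = ℚ.*-cancelʳ-≤-pos (fromℕ xy) {{fromℕ-positive 0<xy}} (begin
    fromℕ k ℚ.* fromℕ xy                                       ≡⟨ fromℕ-* k xy ⟨
    fromℕ (k * xy)                                             ≤⟨ fromℕ-mono-≤ above ⟩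
    fromℕ (K * edges (colored χ γ) X Y + B * xy)               ≡⟨ fromℕ-+ (K * edges (colored χ γ) X Y) (B * xy) ⟩
    fromℕ (K * edges (colored χ γ) X Y) ℚ.+ fromℕ (B * xy)     ≡⟨ cong₂ ℚ._+_
      (trans (fromℕ-* K _) (cong (fromℕ K ℚ.*_) (sym (density-* γ X Y 0<xy)))) (fromℕ-* B xy) ⟩
    fromℕ K ℚ.* (density χ γ X Y ℚ.* fromℕ xy) ℚ.+ fromℕ B ℚ.* fromℕ xy
      ≡⟨ solveℚ 4 (λ K d x B → K ⊗ (d ⊗ x) ⊕ B ⊗ x ≐ (K ⊗ d ⊕ B) ⊗ x) refl (fromℕ K) (density χ γ X Y) (fromℕ xy) (fromℕ B) ⟩
    (fromℕ K ℚ.* density χ γ X Y ℚ.+ fromℕ B) ℚ.* fromℕ xy     ∎)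
    where
    open ℚ.≤-Reasoning
    xy = ∣ X ∣ * ∣ Y ∣

  -- Both densities lie within `1 / P` of the same value, so they differ by at most 2 / P ≤ 1 / M =
  -- ε. The condition ε|A| ≤ |X| reads |A| ≤ M|X|, which also shows X to be nonempty, so that no
  -- density takes the default value.
  concentrated⇒regular : ∀ {M P ε A B} → 0 < M → 2 * M ≤ P → IsReciprocal ε M →
    0 < ∣ A ∣ → 0 < ∣ B ∣ → (∀ γ → Concentrated (colored χ γ) M P A B) → Regular χ ε A B
  concentrated⇒regular {M} {P} {ε} {A} {B} 0<M 2M≤P εM≡1 0<A 0<B conc X Y X⊆A Y⊆B εA≤X εB≤Y γ =
    ∣p-q∣≤r (density χ γ X Y) (density χ γ A B)
      (close {X} {Y} {A} {B} (below X Y X⊆A Y⊆B A≤MX B≤MY) 0<XY (above A B id id A≤MA B≤MB) 0<AB)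
      (close {A} {B} {X} {Y} (below A B id id A≤MA B≤MB) 0<AB (above X Y X⊆A Y⊆B A≤MX B≤MY) 0<XY)
    where
    open Concentrated (conc γ) renaming (B to b; B>0 to 0<b)
    K = P * b
    A≤MX : ∣ A ∣ ≤ M * ∣ X ∣
    A≤MX = reciprocal-≤⁻ εM≡1 εA≤X
    B≤MY : ∣ B ∣ ≤ M * ∣ Y ∣
    B≤MY = reciprocal-≤⁻ εM≡1 εB≤Y
    A≤MA : ∣ A ∣ ≤ M * ∣ A ∣
    A≤MA = ℕ.m≤n*m _ M {{ℕ.>-nonZero 0<M}}
    B≤MB : ∣ B ∣ ≤ M * ∣ B ∣
    B≤MB = ℕ.m≤n*m _ M {{ℕ.>-nonZero 0<M}}
    0<AB : 0 < ∣ A ∣ * ∣ B ∣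
    0<AB = ℕ.*-mono-≤ {1} 0<A 0<B
    0<XY : 0 < ∣ X ∣ * ∣ Y ∣
    0<XY = ℕ.*-mono-≤ {1} (0<factor M 0<A A≤MX) (0<factor M 0<B B≤MY)
    0<K : 0 < K
    0<K = ℕ.*-mono-≤ {1} (ℕ.≤-trans (ℕ.*-mono-≤ {1} {2} (s≤s z≤n) 0<M) 2M≤P) 0<b
    2b≤εK : fromℕ 2 ℚ.* fromℕ b ℚ.≤ ε ℚ.* fromℕ K
    2b≤εK = begin
      fromℕ 2 ℚ.* fromℕ b             ≡⟨ fromℕ-* 2 b ⟨
      fromℕ (2 * b)                   ≡⟨ reciprocal-* εM≡1 (2 * b) ⟨
      ε ℚ.* fromℕ (M * (2 * b))       ≤⟨ ℚ.*-monoˡ-≤-nonNeg ε {{ℚ.pos⇒nonNeg ε {{reciprocal⇒positive εM≡1}}}}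
        (fromℕ-mono-≤ (ℕ.≤-trans (ℕ.≤-reflexive (trans (sym (ℕ.*-assoc M 2 b)) (cong (_* b) (ℕ.*-comm M 2)))) (ℕ.*-monoˡ-≤ b 2M≤P))) ⟩
      ε ℚ.* fromℕ K                   ∎
      where open ℚ.≤-Reasoning
    close : ∀ {X Y X′ Y′} →
      K * edges (colored χ γ) X Y ≤ k * (∣ X ∣ * ∣ Y ∣) + b * (∣ X ∣ * ∣ Y ∣) → 0 < ∣ X ∣ * ∣ Y ∣ →
      k * (∣ X′ ∣ * ∣ Y′ ∣) ≤ K * edges (colored χ γ) X′ Y′ + b * (∣ X′ ∣ * ∣ Y′ ∣) → 0 < ∣ X′ ∣ * ∣ Y′ ∣ →
      density χ γ X Y ℚ.- density χ γ X′ Y′ ℚ.≤ ε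
    close {X} {Y} {X′} {Y′} up 0<XY lo 0<XY′ = ℚ.*-cancelʳ-≤-pos (fromℕ K) {{fromℕ-positive 0<K}} (begin
      (d ℚ.- d′) ℚ.* fromℕ K                          ≡⟨ solveℚ 3 (λ d d′ K → (d ⊝ d′) ⊗ K ≐ K ⊗ d ⊝ K ⊗ d′) refl d d′ (fromℕ K) ⟩
      fromℕ K ℚ.* d ℚ.- fromℕ K ℚ.* d′                ≤⟨ ℚ.+-monoˡ-≤ (ℚ.- (fromℕ K ℚ.* d′))
        (ℚ.≤-trans (density-≤ {K} {b} {k} γ X Y 0<XY up) (ℚ.+-monoˡ-≤ (fromℕ b) (density-≥ {K} {b} {k} γ X′ Y′ 0<XY′ lo))) ⟩
      fromℕ K ℚ.* d′ ℚ.+ fromℕ b ℚ.+ fromℕ b ℚ.- fromℕ K ℚ.* d′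
        ≡⟨ solveℚ 2 (λ x b → x ⊕ b ⊕ b ⊝ x ≐ (conℚ 1ℚ ⊕ conℚ 1ℚ) ⊗ b) refl (fromℕ K ℚ.* d′) (fromℕ b) ⟩
      fromℕ 2 ℚ.* fromℕ b                             ≤⟨ 2b≤εK ⟩
      ε ℚ.* fromℕ K                                   ∎)
      where
      open ℚ.≤-Reasoning
      d = density χ γ X Y
      d′ = density χ γ X′ Y′

-- The starting intervals

interval : ∀ n → ℕ → ℕ → Subset n
interval zero    l       q       = []
interval (suc n) (suc l) q       = outside ∷ interval n l q
interval (suc n) zero    zero    = outside ∷ interval n zero zero
interval (suc n) zero    (suc q) = inside ∷ interval n zero q

∣interval∣ : ∀ n l q → l + q ≤ n → q ≤ ∣ interval n l q ∣
∣interval∣ zero    zero    zero    _         = z≤n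
∣interval∣ (suc n) (suc l) q       (s≤s l+q≤n) = ∣interval∣ n l q l+q≤n
∣interval∣ (suc n) zero    zero    _         = z≤n
∣interval∣ (suc n) zero    (suc q) (s≤s q≤n) = s≤s (∣interval∣ n zero q q≤n)

∈-interval : ∀ {n} l q {a : Fin n} → a ∈ interval n l q → l ≤ toℕ a × toℕ a < l + q
∈-interval {suc n} (suc l) q       (Vec.there a∈) with ∈-interval l q a∈
... | l≤a , a<l+q = s≤s l≤a , s≤s a<l+q
∈-interval {suc n} zero    zero    (Vec.there a∈) with ∈-interval zero zero a∈
... | _ , ()
∈-interval {suc n} zero    (suc q) Vec.here       = z≤n , s≤s z≤n
∈-interval {suc n} zero    (suc q) (Vec.there a∈) = z≤n , s≤s (proj₂ (∈-interval zero q a∈))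

module _ (t n : ℕ) where

  private
    -- Dividing by t + 1 keeps the divisor nonzero; the vertices beyond the t blocks stay uncovered.
    q = n / suc t

  block : Fin t → Subset n
  block j = interval n (toℕ j * q) q

  private
    block-end : ∀ (j : Fin t) {k} → toℕ j < k → toℕ j * q + q ≤ k * q
    block-end j {k} j<k = ℕ.≤-trans (ℕ.≤-reflexive (ℕ.+-comm (toℕ j * q) q)) (ℕ.*-monoˡ-≤ q j<k)

  block-≺ : ∀ j k → j Fin.< k → block j ≺ block k
  block-≺ j k j<k a∈j b∈k = ℕ.<-≤-trans (proj₂ (∈-interval (toℕ j * q) q a∈j))
    (ℕ.≤-trans (block-end j j<k) (proj₁ (∈-interval (toℕ k * q) q b∈k)))

  -- As n ≥ t + 1, the quotient `q` is positive and the remainder is at most q(t + 1), so rounding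
  -- costs no more than a factor 2.
  ∣block∣ : suc t ≤ n → ∀ j → n ≤ 2 * suc t * ∣ block j ∣
  ∣block∣ t<n j = begin
    n                                 ≡⟨ m≡m%n+[m/n]*n n (suc t) ⟩
    n ℕ.% suc t + q * suc t           ≤⟨ ℕ.+-monoˡ-≤ (q * suc t) (ℕ.≤-trans (ℕ.<⇒≤ (m%n<n n (suc t)))
                                           (ℕ.m≤n*m (suc t) q {{ℕ.>-nonZero (m≥n⇒m/n>0 t<n)}})) ⟩
    q * suc t + q * suc t             ≡⟨ solve 2 (λ q t → q :* t :+ q :* t := con 2 :* t :* q) refl q (suc t) ⟩
    2 * suc t * q                     ≤⟨ ℕ.*-monoʳ-≤ (2 * suc t) (∣interval∣ n (toℕ j * q) q
      (ℕ.≤-trans (block-end j (Fin.toℕ<n j)) (ℕ.≤-trans (ℕ.*-monoˡ-≤ q (ℕ.n≤1+n t))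
        (ℕ.≤-trans (ℕ.≤-reflexive (ℕ.*-comm (suc t) q)) (m/n*n≤m n (suc t)))))) ⟩
    2 * suc t * ∣ block j ∣           ∎
    where open ℕ.≤-Reasoning

-- Real sums and minima

≤ᴿ-eventually : ∀ x y N → (∀ n → N ≤ n → seq x n ℚ.≤ seq y n) → x ≤ᴿ y
≤ᴿ-eventually x y N x≤y ε 0<ε = N , λ n N≤n → ℚ.≤-trans (x≤y n N≤n)
  (ℚ.≤-trans (ℚ.≤-reflexive (sym (ℚ.+-identityʳ (seq y n)))) (ℚ.+-monoʳ-≤ (seq y n) (ℚ.<⇒≤ 0<ε)))

minimumᴿ-≤ : ∀ {x xs} → x ∈ˡ xs → ∀ n → seq (minimumᴿ xs) n ℚ.≤ seq x n
minimumᴿ-≤ {xs = _ ∷ []}     (here refl) n = ℚ.≤-refl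
minimumᴿ-≤ {xs = y ∷ z ∷ xs} (here refl) n = ℚ.p⊓q≤p (seq y n) (seq (minimumᴿ (z ∷ xs)) n)
minimumᴿ-≤ {xs = y ∷ z ∷ xs} (there x∈)  n =
  ℚ.≤-trans (ℚ.p⊓q≤q (seq y n) (seq (minimumᴿ (z ∷ xs)) n)) (minimumᴿ-≤ x∈ n)

sumᴿ-cong : ∀ {A : Set} (f g : A → ℝ) n → (∀ i → seq (f i) n ≡ seq (g i) n) →
  ∀ is → seq (sumᴿ (map f is)) n ≡ seq (sumᴿ (map g is)) n
sumᴿ-cong f g n f≗g []       = refl
sumᴿ-cong f g n f≗g (i ∷ is) = cong₂ ℚ._+_ (f≗g i) (sumᴿ-cong f g n f≗g is)

sumᴿ-≤-filter : ∀ {A : Set} {P : A → Set} (P? : ∀ i → Dec (P i)) (f g : A → ℝ) n →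
  (∀ i → P i → seq (f i) n ℚ.≤ seq (g i) n) → (∀ i → ¬ P i → seq (f i) n ℚ.≤ 0ℚ) → ∀ is →
  seq (sumᴿ (map f is)) n ℚ.≤ seq (sumᴿ (map g (filter P? is))) n
sumᴿ-≤-filter P? f g n f≤g f≤0 []       = ℚ.≤-refl
sumᴿ-≤-filter P? f g n f≤g f≤0 (i ∷ is) with P? i
... | yes p = ℚ.+-mono-≤ (f≤g i p) (sumᴿ-≤-filter P? f g n f≤g f≤0 is)
... | no ¬p = ℚ.≤-trans (ℚ.+-mono-≤ (f≤0 i ¬p) (sumᴿ-≤-filter P? f g n f≤g f≤0 is))
                        (ℚ.≤-reflexive (ℚ.+-identityˡ (seq (sumᴿ (map g (filter P? is))) n)))

seq-*ᴿ-fromℚ : ∀ x p n → seq (x *ᴿ fromℚ p) n ≡ seq x n ℚ.* p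
seq-*ᴿ-fromℚ x p n = refl

*ᴿ-fromℚ-mono-≤ : ∀ x {p q} n → 0ℚ ℚ.≤ seq x n → p ℚ.≤ q → seq (x *ᴿ fromℚ p) n ℚ.≤ seq (x *ᴿ fromℚ q) n
*ᴿ-fromℚ-mono-≤ x {p} {q} n 0≤x p≤q = subst₂ ℚ._≤_ (sym (seq-*ᴿ-fromℚ x p n)) (sym (seq-*ᴿ-fromℚ x q n))
  (ℚ.*-monoˡ-≤-nonNeg (seq x n) {{ℚ.nonNegative 0≤x}} p≤q)

*ᴿ-fromℚ-zero : ∀ x {p} n → p ≡ 0ℚ → seq (x *ᴿ fromℚ p) n ≡ 0ℚ
*ᴿ-fromℚ-zero x n refl = trans (seq-*ᴿ-fromℚ x 0ℚ n) (ℚ.*-zeroʳ (seq x n))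

eventually-nonNegative : ∀ {c} (wt : Fin c → ℝ) → (∀ i → 0ᴿ <ᴿ wt i) →
  ∃[ N ] (∀ n → N ≤ n → ∀ i → 0ℚ ℚ.≤ seq (wt i) n)
-- The sum of the thresholds dominates each of them and so serves all `i` at once.
eventually-nonNegative wt wt>0 = ∑ N , λ n ∑N≤n i → let (ε , 0<ε , _ , wt≥ε) = wt>0 i in
  ℚ.≤-trans (ℚ.<⇒≤ 0<ε) (ℚ.≤-trans (ℚ.≤-reflexive (sym (ℚ.+-identityˡ ε)))
    (wt≥ε n (ℕ.≤-trans (∑-≥-term N i) ∑N≤n)))
  where
  N : Fin _ → ℕ
  N i = proj₁ (proj₂ (proj₂ (wt>0 i)))

-- Counts of monochromatic copies

module _ {n c : ℕ} where

  hasColor-cong : ∀ {χ χ′ : Coloring n c} → (∀ a b .(a<b : a Fin.< b) → χ a b a<b ≡ χ′ a b a<b) →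
    ∀ {γ a b} → HasColor χ γ a b → HasColor χ′ γ a b
  hasColor-cong χ≗χ′ {γ} {a} {b} (inj₁ (a<b , eq)) = inj₁ (a<b , trans (sym (χ≗χ′ a b a<b)) eq)
  hasColor-cong χ≗χ′ {γ} {a} {b} (inj₂ (b<a , eq)) = inj₂ (b<a , trans (sym (χ≗χ′ b a b<a)) eq)

  #monoCopies-cong : ∀ {χ χ′ : Coloring n c} → (∀ a b .(a<b : a Fin.< b) → χ a b a<b ≡ χ′ a b a<b) →
    ∀ i H → #monoCopies χ i H ≡ #monoCopies χ′ i H
  #monoCopies-cong {χ} {χ′} χ≗χ′ i H = begin
    #monoCopies χ i H                                         ≡⟨ length-filter (isMonoCopy? χ i H) (maps (v H) n) ⟩
    Σₗ (map (λ f → 𝟙 (isMonoCopy? χ i H f)) (maps (v H) n))   ≡⟨ cong Σₗ (List.map-cong (λ f →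
      𝟙-cong (isMonoCopy? χ i H f) (isMonoCopy? χ′ i H f)
        (λ (inc , col) → inc , λ x y adj → hasColor-cong χ≗χ′ (col x y adj))
        (λ (inc , col) → inc , λ x y adj → hasColor-cong (λ a b a<b → sym (χ≗χ′ a b a<b)) (col x y adj))) (maps (v H) n)) ⟩
    Σₗ (map (λ f → 𝟙 (isMonoCopy? χ′ i H f)) (maps (v H) n))  ≡⟨ length-filter (isMonoCopy? χ′ i H) (maps (v H) n) ⟨
    #monoCopies χ′ i H                                        ∎
    where open ≡-Reasoning

  -- An increasing map is injective. With t in place of `n`, colours outside J_t therefore add
  -- nothing to the weight of a reduced colouring.
  #monoCopies-large : ∀ (χ : Coloring n c) i H → n < v H → #monoCopies χ i H ≡ 0
  #monoCopies-large χ i H n<h = cong length (List.filter-none (isMonoCopy? χ i H) (All.universal none (maps (v H) n)))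
    where
    none : ∀ f → ¬ IsMonoCopy χ i H f
    none f (inc , _) = ℕ.<⇒≱ n<h (Fin.injective⇒≤ {f = f} (increasing⇒injective inc))

  -- The enumerated assignments are defined on all ordered pairs, so `ρ` is first extended by the
  -- arbitrary colour `γ`.
  colorings-complete : Fin c → (ρ : Coloring n c) →
    ∃[ χ ] (χ ∈ˡ colorings n c × (∀ a b .(a<b : a Fin.< b) → ρ a b a<b ≡ χ a b a<b))
  colorings-complete γ ρ = _ , ∈-map⁺ enumerate (∈-allFin (funToFin (total ∘ remQuot n)))
    , λ a b a<b → sym (trans (Fin.finToFun-funToFin (total ∘ remQuot n) (combine a b))
        (trans (cong total (Fin.remQuot-combine a b)) (total-< a b a<b)))
    where
    enumerate : Fin (c ^ (n * n)) → Coloring n c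
    enumerate k a b _ = finToFun k (combine a b)
    total : Fin n × Fin n → Fin c
    total (a , b) with a Fin.<? b
    ... | yes a<b = ρ a b a<b
    ... | no _    = γ
    total-< : ∀ a b .(a<b : a Fin.< b) → total (a , b) ≡ ρ a b a<b
    total-< a b a<b with a Fin.<? b
    ... | yes _   = refl
    ... | no a≮b  = contradiction-irr a<b a≮b

  -- The minimum is formed termwise on sequences, so the inequality holds at every index. A listed
  -- colouring agreeing with `ρ` on all edges has the same weight there.
  minWeight-≤ : Fin c → (wt : Fin c → ℝ) (G : Fin c → OrderedGraph) (ρ : Coloring n c) →
    ∀ m → seq (minWeight wt n G) m ℚ.≤ seq (weight wt G ρ) m
  minWeight-≤ γ wt G ρ m = ℚ.≤-trans (minimumᴿ-≤ (∈-map⁺ (weight wt G) (proj₁ (proj₂ complete-ρ))) m)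
    (ℚ.≤-reflexive (sumᴿ-cong (term (proj₁ complete-ρ)) (term ρ) m
      (λ i → cong (λ N → seq (wt i *ᴿ fromℚ (fromℕ N)) m) (sym (#monoCopies-cong (proj₂ (proj₂ complete-ρ)) i (G i)))) (allFin c)))
    where
    complete-ρ = colorings-complete γ ρ
    term : Coloring n c → Fin c → ℝ
    term χ i = wt i *ᴿ fromℚ (fromℕ (#monoCopies χ i (G i)))

^≤∏ : ∀ {h} n A (f : Fin h → ℕ) → (∀ j → n ≤ A * f j) → n ^ h ≤ A ^ h * ∏ f
^≤∏ {zero}  n A f n≤ = ℕ.≤-refl
^≤∏ {suc h} n A f n≤ = ℕ.≤-trans (ℕ.*-mono-≤ (n≤ zero) (^≤∏ n A (f ∘ suc) (n≤ ∘ suc)))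
  (ℕ.≤-reflexive (solve 4 (λ a x p q → (a :* x) :* (p :* q) := (a :* p) :* (x :* q)) refl A (f zero) (A ^ h) (∏ (f ∘ suc))))

length*≤Σₗ : ∀ {X : Set} {p q} (g : X → ℕ) → (∀ x → p ≤ q * g x) → ∀ xs → length xs * p ≤ q * Σₗ (map g xs)
length*≤Σₗ g p≤ []       = z≤n
length*≤Σₗ {p = p} {q} g p≤ (x ∷ xs) = ℕ.≤-trans (ℕ.+-mono-≤ (p≤ x) (length*≤Σₗ {p = p} {q} g p≤ xs))
  (ℕ.≤-reflexive (sym (ℕ.*-distribˡ-+ q (g x) _)))

#monoCopies*≤clusterVolume : ∀ {n c t A} (χ : Coloring n c) (W : Fin t → Subset n) (ρ : Coloring t c) i H →
  (∀ j → n ≤ A * ∣ W j ∣) → #monoCopies ρ i H * n ^ v H ≤ A ^ v H * clusterVolume χ W ρ i H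
#monoCopies*≤clusterVolume {n} {A = A} χ W ρ i H n≤AW = length*≤Σₗ {p = n ^ v H} {A ^ v H} _
  (λ F → ℕ.≤-trans (^≤∏ n A (λ ℓ → ∣ W (F ℓ) ∣) (λ ℓ → n≤AW (F ℓ)))
    (ℕ.≤-reflexive (cong (A ^ v H *_) (sym (∏-allFin (λ ℓ → ∣ W (F ℓ) ∣))))))
  (monoCopies ρ i H)

-- The denominator equals n^h / (D A^h) and is positive because n is, so `÷₀` is genuine division
-- and the claim is `bound` with denominators cleared.
normalized-≥ : ∀ {d α D A n h N T} → IsReciprocal d D → IsReciprocal α A → 0 < n →
  N * n ^ h ≤ A ^ h * (D * T) → fromℕ N ℚ.≤ fromℕ T ÷₀ (d ℚ.* (α ℚ.* fromℕ n) ^ℚ h)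
normalized-≥ {d} {α} {D} {A} {n} {h} {N} {T} dD αA 0<n bound = ℚ.*-cancelʳ-≤-pos x {{x-positive}} (begin
  fromℕ N ℚ.* x                        ≡⟨ cong (fromℕ N ℚ.*_) x≡ ⟩
  fromℕ N ℚ.* (y ℚ.* fromℕ (n ^ h))    ≡⟨ ℚ.*-assoc (fromℕ N) y (fromℕ (n ^ h)) ⟨
  fromℕ N ℚ.* y ℚ.* fromℕ (n ^ h)      ≡⟨ cong (ℚ._* fromℕ (n ^ h)) (ℚ.*-comm (fromℕ N) y) ⟩
  y ℚ.* fromℕ N ℚ.* fromℕ (n ^ h)      ≡⟨ ℚ.*-assoc y (fromℕ N) (fromℕ (n ^ h)) ⟩
  y ℚ.* (fromℕ N ℚ.* fromℕ (n ^ h))    ≡⟨ cong (y ℚ.*_) (fromℕ-* N (n ^ h)) ⟨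
  y ℚ.* fromℕ (N * n ^ h)              ≤⟨ reciprocal-≤ y-reciprocal (ℕ.≤-trans bound (ℕ.≤-reflexive
    (solve 3 (λ a d t → a :* (d :* t) := d :* a :* t) refl (A ^ h) D T))) ⟩
  fromℕ T                              ≡⟨ ÷₀-* (fromℕ T) x {{x-positive}} ⟨
  fromℕ T ÷₀ x ℚ.* x                   ∎)
  where
  open ℚ.≤-Reasoning
  x = d ℚ.* (α ℚ.* fromℕ n) ^ℚ h
  y = d ℚ.* α ^ℚ h
  y-reciprocal : IsReciprocal y (D * A ^ h)
  y-reciprocal = *-reciprocal dD (^ℚ-reciprocal αA h)
  x≡ : x ≡ y ℚ.* fromℕ (n ^ h)
  x≡ = trans (cong (d ℚ.*_) (trans (^ℚ-distrib-* α (fromℕ n) h) (cong (α ^ℚ h ℚ.*_) (sym (fromℕ-^ n h)))))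
    (sym (ℚ.*-assoc d (α ^ℚ h) (fromℕ (n ^ h))))
  x-positive : ℚ.Positive x
  x-positive = subst ℚ.Positive (sym x≡) (ℚ.pos*pos⇒pos y {{reciprocal⇒positive y-reciprocal}}
    (fromℕ (n ^ h)) {{fromℕ-positive (ℕ.m^n>0 n {{ℕ.>-nonZero 0<n}} h)}})

-- A positive real may have negative initial terms, so the sums are compared only from an index at
-- which all weights are nonnegative. The terms removed by the filter vanish by `#monoCopies-large`.
minWeight-≤-sum : ∀ {c t} → 0 < c → (wt : Fin c → ℝ) → (∀ i → 0ᴿ <ᴿ wt i) → (G : Fin c → OrderedGraph) →
  (ρ : Coloring t c) (g : Fin c → ℚ) → (∀ i → v (G i) ≤ t → fromℕ (#monoCopies ρ i (G i)) ℚ.≤ g i) →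
  minWeight wt t G ≤ᴿ sumᴿ (map (λ i → wt i *ᴿ fromℚ (g i)) (filter (λ i → v (G i) ℕ.≤? t) (allFin c)))
minWeight-≤-sum {c} {t} 0<c wt wt>0 G ρ g copies≤g =
  ≤ᴿ-eventually (minWeight wt t G) (sumᴿ (map (λ i → wt i *ᴿ fromℚ (g i)) (filter (λ i → v (G i) ℕ.≤? t) (allFin c))))
    (proj₁ wt≥0) λ m N≤m → ℚ.≤-trans
      (minWeight-≤ (Fin.fromℕ< 0<c) wt G ρ m)
      (sumᴿ-≤-filter (λ i → v (G i) ℕ.≤? t)
        (λ i → wt i *ᴿ fromℚ (fromℕ (#monoCopies ρ i (G i)))) (λ i → wt i *ᴿ fromℚ (g i)) m
        (λ i h≤t → *ᴿ-fromℚ-mono-≤ (wt i) m (proj₂ wt≥0 m N≤m i) (copies≤g i h≤t))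
        (λ i h≰t → ℚ.≤-reflexive (*ᴿ-fromℚ-zero (wt i) m (cong fromℕ (#monoCopies-large ρ i (G i) (ℕ.≰⇒> h≰t)))))
        (allFin c))
  where
  wt≥0 : ∃[ N ] (∀ n → N ≤ n → ∀ i → 0ℚ ℚ.≤ seq (wt i) n)
  wt≥0 = eventually-nonNegative wt wt>0

-- Choice of constants and assembly

0<reciprocal : ∀ {x m} → IsReciprocal x m → 0ℚ ℚ.< x
0<reciprocal {x} xm = ℚ.positive⁻¹ x {{reciprocal⇒positive xm}}

hasReciprocal : ∀ {m} → 0 < m → ∃[ x ] IsReciprocal x m
hasReciprocal 0<m = _ , ÷₀-reciprocal 0<m

Clusters : ∀ {n c t} (M P A : ℕ) → Coloring n c → Set
Clusters {n} {c} {t} M P A χ = Σ[ W ∈ (Fin t → Subset n) ] (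
  (∀ a b → a Fin.< b → W a ≺ W b) ×
  (∀ j → n ≤ A * ∣ W j ∣) ×
  (∀ a b → a Fin.< b → ∀ γ → Concentrated (colored χ γ) M P (W a) (W b)))

-- The factor `2 * suc t` is lost in passing to the intervals and `Q` in regularising them. Neither
-- depends on n or on the colouring.
hasClusters : ∀ c t M P → 0 < M → 0 < P → ∃[ A ] (0 < A × ∀ {n} → suc t ≤ n → (χ : Coloring n c) → Clusters {n} {c} {t} M P A χ)
hasClusters c t M P 0<M 0<P = 2 * suc t * Q , ℕ.*-mono-≤ {1} {2 * suc t} (s≤s z≤n) (proj₁ (proj₂ reg)) , clusters
  where
  reg = regularize {t} {c} M P 0<M 0<P (cartesianProduct (allFin t) (cartesianProduct (allFin t) (allFin c)))
  Q = proj₁ reg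
  clusters : ∀ {n} → suc t ≤ n → (χ : Coloring n c) → Clusters {n} {c} {t} M P (2 * suc t * Q) χ
  clusters {n} t<n χ with proj₂ (proj₂ reg) (colored χ) (λ γ a b → 𝟙≤1 (hasColor? χ γ a b)) (block t n)
  ... | W , W⊆block , block≤QW , conc = W
    , (λ a b a<b x∈ y∈ → block-≺ t n a b a<b (W⊆block a x∈) (W⊆block b y∈))
    , (λ j → ℕ.≤-trans (∣block∣ t n t<n j) (ℕ.≤-trans (ℕ.*-monoʳ-≤ (2 * suc t) (block≤QW j))
        (ℕ.≤-reflexive (sym (ℕ.*-assoc (2 * suc t) Q ∣ W j ∣)))))
    , (λ a b a<b γ → All.lookup conc
        (∈-cartesianProduct⁺ (∈-allFin a) (∈-cartesianProduct⁺ (∈-allFin b) (∈-allFin γ))) a<b)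

regularCopies : ∀ {c G wt t n ε α} M P A → 0 < c → (∀ i → 0ᴿ <ᴿ wt i) → suc t ≤ n → 0 < M →
  (∀ {h} → h ≤ t → 2 * (h * (2 * c) ^ h) ≤ M) → 4 * c ≤ P → 2 * M ≤ P → IsReciprocal ε M → IsReciprocal α A →
  (χ : Coloring n c) → Clusters {n} {c} {t} M P A χ →
  Σ[ W ∈ (Fin t → Subset n) ] (
    (∀ a b → a Fin.< b → W a ≺ W b) ×
    (∀ j → α ℚ.* fromℕ n ℚ.≤ fromℕ ∣ W j ∣) ×
    (∀ a b → a Fin.< b → Regular χ ε (W a) (W b)) ×
    ((ρ : Coloring t c) → IsReducedColoring χ W ρ →
      let δᵢ : Fin c → ℚ
          δᵢ i = δ (v (G i)) (1ℚ ÷₀ fromℕ c)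
          T : Fin c → ℕ
          T i = #regCopies χ W ρ i (G i)
      in
      (∀ i → v (G i) ≤ t → δᵢ i ℚ.* fromℕ (clusterVolume χ W ρ i (G i)) ℚ.≤ fromℕ (T i)) ×
      (minWeight wt t G ≤ᴿ
        sumᴿ (map (λ i → wt i *ᴿ fromℚ (fromℕ (T i) ÷₀ (δᵢ i ℚ.* (α ℚ.* fromℕ n) ^ℚ v (G i))))
          (filter (λ i → v (G i) ℕ.≤? t) (allFin c))))))
regularCopies {c} {G} {wt} {t} {n} {ε} {α} M P A 0<c wt>0 t<n 0<M large 4c≤P 2M≤P εM αA χ (W , ordered , n≤AW , conc) =
  W , ordered , (λ j → reciprocal-≤ αA (n≤AW j))
  , (λ a b a<b → concentrated⇒regular χ 0<M 2M≤P εM (0<W a) (0<W b) (conc a b a<b))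
  , λ ρ isReduced → (λ i h≤t → reciprocal-≤ (δ-recip i) (volume ρ isReduced i h≤t))
    , minWeight-≤-sum 0<c wt wt>0 G ρ
        (λ i → fromℕ (#regCopies χ W ρ i (G i)) ÷₀ (δ (v (G i)) (1ℚ ÷₀ fromℕ c) ℚ.* (α ℚ.* fromℕ n) ^ℚ v (G i)))
        (λ i h≤t → normalized-≥ {h = v (G i)} {#monoCopies ρ i (G i)} {#regCopies χ W ρ i (G i)} (δ-recip i) αA 0<n
          (ℕ.≤-trans (#monoCopies*≤clusterVolume {A = A} χ W ρ i (G i) n≤AW)
            (ℕ.*-monoʳ-≤ (A ^ v (G i)) (volume ρ isReduced i h≤t))))
  where
  0<n : 0 < n
  0<n = ℕ.≤-trans (s≤s z≤n) t<n
  0<W : ∀ j → 0 < ∣ W j ∣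
  0<W j = 0<factor A 0<n (n≤AW j)
  δ-recip : ∀ i → IsReciprocal (δ (v (G i)) (1ℚ ÷₀ fromℕ c)) (1/δ (v (G i)) c)
  δ-recip i = δ-reciprocal (v (G i)) (÷₀-reciprocal 0<c)
  volume : ∀ ρ → IsReducedColoring χ W ρ → ∀ i → v (G i) ≤ t →
    clusterVolume χ W ρ i (G i) ≤ 1/δ (v (G i)) c * #regCopies χ W ρ i (G i)
  volume ρ isReduced i h≤t = clusterVolume-≤-#regCopies χ W ordered ρ i (G i) 0<c (large h≤t) 0<M 4c≤P 0<W
    (λ a b a<b → conc a b a<b i)
    -- Here `a<b` is irrelevant; decidability of the order recovers a proof that `ordered` accepts.
    λ a b a<b → densest χ (ordered a b (recompute (a Fin.<? b) a<b)) (ρ a b a<b) λ γ →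
      density-≤⇒edges-≤ χ γ (ρ a b a<b) (W a) (W b) (ℕ.*-mono-≤ {1} (0<W a) (0<W b)) (isReduced a b a<b γ)

theorem5p7 :
    (c : ℕ) → 2 ℕ.≤ c →
    (G : Fin c → OrderedGraph) → (∀ i → HasEdge (G i)) →
    (wt : Fin c → ℝ) → (∀ i → 0ᴿ <ᴿ wt i) →
    (R : ℕ) → IsRamseyNumber G R →
    (t : ℕ) → R ℕ.≤ t →
    let h : Fin c → ℕ
        h i = v (G i)
        δᵢ : Fin c → ℚ
        δᵢ i = δ (h i) (1ℚ ÷₀ fromℕ c)
    in
    Σ[ ε ∈ ℚ ] Σ[ α ∈ ℚ ] Σ[ n₀ ∈ ℕ ] (0ℚ ℚ.< ε × 0ℚ ℚ.< α ×
      ((n : ℕ) → n₀ ℕ.≤ n → (χ : Coloring n c) →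
        Σ[ W ∈ (Fin t → Subset n) ] (
          (∀ a b → a Fin.< b → W a ≺ W b) ×
          (∀ j → α ℚ.* fromℕ n ℚ.≤ fromℕ ∣ W j ∣) ×
          (∀ a b → a Fin.< b → Regular χ ε (W a) (W b)) ×
          ((ρ : Coloring t c) → IsReducedColoring χ W ρ →
            let T : Fin c → ℕ
                T i = #regCopies χ W ρ i (G i)
            in
            (∀ i → h i ℕ.≤ t → δᵢ i ℚ.* fromℕ (clusterVolume χ W ρ i (G i)) ℚ.≤ fromℕ (T i)) ×
            (minWeight wt t G ≤ᴿ
              sumᴿ (map (λ i → wt i *ᴿ fromℚ (fromℕ (T i) ÷₀ (δᵢ i ℚ.* (α ℚ.* fromℕ n) ^ℚ h i)))
                (filter (λ i → h i ℕ.≤? t) (allFin c))))))))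
theorem5p7 c 2≤c G _ wt wt>0 _ _ t _ =
  -- The threshold n₀ = t + 1 makes the starting intervals nonempty.
  proj₁ ε , proj₁ α , suc t , 0<reciprocal (proj₂ ε) , 0<reciprocal (proj₂ α) , λ n t<n χ →
    regularCopies {c} {G} {wt} {t} {n} {proj₁ ε} {proj₁ α} M P (proj₁ clusters) 0<c wt>0 t<n (s≤s z≤n)
      large 4c≤P 2M≤P (proj₂ ε) (proj₂ α) χ (proj₂ (proj₂ clusters) t<n χ)
  where
  0<c : 0 < c
  0<c = ℕ.≤-trans (s≤s z≤n) 2≤c
  instance
    _ = ℕ.>-nonZero 0<c
  M P : ℕ
  -- Embedding h vertices needs M ≥ 2h(2c)^h; the value at t covers all h ≤ t, and the successor
  -- makes `M` positive.
  M = suc (2 * (t * (2 * c) ^ t))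
  -- Large enough for two purposes: 4c for the density bound on sub-pairs of reduced edges, and 2M
  -- for regularity with ε = 1 / M.
  P = 4 * (c * M)
  4c≤P : 4 * c ≤ P
  4c≤P = ℕ.*-monoʳ-≤ 4 (ℕ.m≤m*n c M)
  2M≤P : 2 * M ≤ P
  2M≤P = ℕ.*-mono-≤ {2} {4} (s≤s (s≤s z≤n)) (ℕ.m≤n*m M c)
  large : ∀ {h} → h ≤ t → 2 * (h * (2 * c) ^ h) ≤ M
  large {h} h≤t = ℕ.≤-trans (ℕ.*-monoʳ-≤ 2 (ℕ.*-mono-≤ h≤t (ℕ.^-monoʳ-≤ (2 * c) {{ℕ.m*n≢0 2 c}} h≤t))) (ℕ.n≤1+n _)
  clusters : ∃[ A ] (0 < A × ∀ {n} → suc t ≤ n → (χ : Coloring n c) → Clusters {n} {c} {t} M P A χ)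
  clusters = hasClusters c t M P (s≤s z≤n) (ℕ.*-mono-≤ {1} {4} (s≤s z≤n) (ℕ.*-mono-≤ {1} 0<c (s≤s z≤n)))
  ε : ∃[ x ] IsReciprocal x M
  ε = hasReciprocal (s≤s z≤n)
  α : ∃[ x ] IsReciprocal x (proj₁ clusters)
  α = hasReciprocal (proj₁ (proj₂ clusters))
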